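{- Every interval $[u,v]$ of a finite semidistrim lattice is a semidistrim lattice.
   Context: All lattices are finite. For a lattice $L$, $\mathcal{J}_L$ (resp. $\mathcal{M}_L$) is the set of join-irreducible (resp. meet-irreducible) elements; for $j\in\mathcal{J}_L$, $j_*$ is the unique element covered by $j$, and for $m\in\mathcal{M}_L$, $m^*$ is the unique element covering $m$. Let $\mathcal{M}_L(j)=\max\{z\in L: j_*=j\wedge z\}$ and $\mathcal{J}_L(m)=\min\{z\in L: m^*=m\vee z\}$. A pairing on $L$ is a bijection $\kappa:\mathcal{J}_L\to\mathcal{M}_L$ with $\kappa(j)\in\mathcal{M}_L(j)$ for all $j$ and $\kappa^{ -1}(m)\in\mathcal{J}_L(m)$ for all $m$; $L$ is uniquely paired if it has exactly one pairing, denoted $\kappa_L$. A prime pair is a pair $(j_0,m_0)$ with $L=[\hat0,m_0]\sqcup[j_0,\hat1]$. A uniquely paired lattice $L$ is compatibly dismantlable if $|L|=1$ or there is a prime pair $(j_0,m_0)$ such that: (i) $[j_0,\hat1]$ is compatibly dismantlable and $\alpha(j)=j_0\vee j$ defines a bijection $\{j\in\mathcal{J}_L: j_0\le\kappa_L(j)\}\to\mathcal{J}_{[j_0,\hat1]}$ with $\kappa_{[j_0,\hat1]}(\alpha(j))=\kappa_L(j)$; (ii) $[\hat0,m_0]$ is compatibly dismantlable and $\beta(m)=m_0\wedge m$ defines a bijection $\{m\in\mathcal{M}_L:\kappa_L^{ -1}(m)\le m_0\}\to\mathcal{M}_{[\hat0,m_0]}$ with $\kappa_{[\hat0,m_0]}^{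 -1}(\beta(m))=\kappa_L^{ -1}(m)$. The Galois graph $G_L$ is the directed graph on $\mathcal{J}_L$ with an edge $j\to j'$ iff $j\ne j'$ and $j\not\le\kappa_L(j')$. For $x\in L$ let $J_L(x)=\{j\in\mathcal{J}_L:j\le x\}$ and $M_L(x)=\{j\in\mathcal{J}_L:\kappa_L(j)\ge x\}$. For a compatibly dismantlable $L$, for every cover $x\lessdot y$ the set $M_L(x)\cap J_L(y)$ has exactly one element $j_{xy}$; set $\mathcal{D}_L(x)=\{j_{yx}:y\lessdot x\}$ and $\mathcal{U}_L(x)=\{j_{xy}:x\lessdot y\}$. $L$ is semidistrim if it is compatibly dismantlable and $\mathcal{D}_L(x)$, $\mathcal{U}_L(x)$ are independent sets (no two elements adjacent) of $G_L$ for all $x\in L$. -}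

module Defs where

open import Data.Bool using (Bool; true; false; T; _∧_)
open import Data.Bool.Properties using (T-∧)
open import Data.Unit using (tt)
open import Data.Empty using (⊥)
open import Data.Product using (Σ; Σ-syntax; _×_; _,_; proj₁; proj₂)
open import Data.Sum using (_⊎_)
open import Data.List using (List)
open import Data.List.Membership.Propositional using (_∈_)
open import Relation.Nullary using (¬_)
open import Relation.Binary.PropositionalEquality
  using (_≡_; _≢_; refl; cong)
open import Function.Bundles using (Equivalence)

-- Posets with a Bool-valued order (so that proofs of x ≤ y are
-- proof-irrelevant and subposets are well behaved).

record BPoset : Set₁ where
  field
    C      : Set
    _≤ᵇ_   : C → C → Bool
    ≤-refl  : ∀ x → T (x ≤ᵇ x)
    ≤-antisym : ∀ x y → T (x ≤ᵇ y) → T (y ≤ᵇ x) → x ≡ y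
    ≤-trans : ∀ x y z → T (x ≤ᵇ y) → T (y ≤ᵇ z) → T (x ≤ᵇ z)

module _ (L : BPoset) where
  open BPoset L

  _≤_ : C → C → Set
  x ≤ y = T (x ≤ᵇ y)

  Finite : Set
  Finite = Σ (List C) λ l → ∀ x → x ∈ l

  IsMeet : C → C → C → Set
  IsMeet a b c = c ≤ a × c ≤ b × (∀ w → w ≤ a → w ≤ b → w ≤ c)

  IsJoin : C → C → C → Set
  IsJoin a b c = a ≤ c × b ≤ c × (∀ w → a ≤ w → b ≤ w → c ≤ w)

  record IsLattice : Set where
    field
      _∨_ : C → C → C
      _⊓_ : C → C → C
      ∨-isJoin : ∀ x y → IsJoin x y (x ∨ y)
      ⊓-isMeet : ∀ x y → IsMeet x y (x ⊓ y)

  _⋖_ : C → C → Set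
  x ⋖ y = x ≤ y × x ≢ y × (∀ z → x ≤ z → z ≤ y → (z ≡ x) ⊎ (z ≡ y))

  JI : C → Set
  JI j = Σ C λ s → s ⋖ j × (∀ s' → s' ⋖ j → s' ≡ s)

  MI : C → Set
  MI m = Σ C λ t → m ⋖ t × (∀ t' → m ⋖ t' → t' ≡ t)

  InMset : (j : C) → JI j → C → Set
  InMset j jj z = IsMeet j z (proj₁ jj)
                × (∀ z' → IsMeet j z' (proj₁ jj) → z ≤ z' → z' ≡ z)

  InJset : (m : C) → MI m → C → Set
  InJset m mm z = IsJoin m z (proj₁ mm)
                × (∀ z' → IsJoin m z' (proj₁ mm) → z' ≤ z → z' ≡ z)

  record Pairing (κ : C → C) : Set where
    field
      maps : ∀ j → (jj : JI j) → MI (κ j)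
      inj  : ∀ j j' → JI j → JI j' → κ j ≡ κ j' → j ≡ j'
      surj : ∀ m → MI m → Σ C λ j → JI j × κ j ≡ m
      inM  : ∀ j → (jj : JI j) → InMset j jj (κ j)
      inJ  : ∀ j → (jj : JI j) → InJset (κ j) (maps j jj) j

  record UniquelyPaired : Set where
    field
      lattice : IsLattice
      κ       : C → C
      pairing : Pairing κ
      unique  : ∀ κ' → Pairing κ' → ∀ j → JI j → κ' j ≡ κ j

  PrimePair : C → C → Set
  PrimePair j0 m0 = ∀ x → (x ≤ m0 × ¬ (j0 ≤ x)) ⊎ (j0 ≤ x × ¬ (x ≤ m0))

Sub : (L : BPoset) → (BPoset.C L → Bool) → BPoset
Sub L p = record
  { C = Σ C (λ x → T (p x))
  ; _≤ᵇ_ = λ x y → proj₁ x ≤ᵇ proj₁ y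
  ; ≤-refl = λ x → ≤-refl (proj₁ x)
  ; ≤-antisym = antisym'
  ; ≤-trans = λ x y z → ≤-trans (proj₁ x) (proj₁ y) (proj₁ z)
  }
  where
  open BPoset L
  T-irr : ∀ b → (s t : T b) → s ≡ t
  T-irr true _ _ = refl
  antisym' : (x y : Σ C (λ x → T (p x))) → T (proj₁ x ≤ᵇ proj₁ y) →
             T (proj₁ y ≤ᵇ proj₁ x) → x ≡ y
  antisym' (x , s) (y , t) a b with ≤-antisym x y a b
  ... | refl = cong (x ,_) (T-irr (p x) s t)

Interval : (L : BPoset) → BPoset.C L → BPoset.C L → BPoset
Interval L u v = Sub L (λ x → (u ≤ᵇ x) ∧ (x ≤ᵇ v)) where open BPoset L

UpSet : (L : BPoset) → BPoset.C L → BPoset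
UpSet L j0 = Sub L (λ x → j0 ≤ᵇ x) where open BPoset L

DownSet : (L : BPoset) → BPoset.C L → BPoset
DownSet L m0 = Sub L (λ x → x ≤ᵇ m0) where open BPoset L

module _ (L : BPoset) (up : UniquelyPaired L) where
  open BPoset L using (C)
  open UniquelyPaired up
  open IsLattice lattice

  -- condition (i): α(j) = j0 ∨ j is a bijection
  -- {j ∈ J_L : j0 ≤ κ_L j} → J_[j0,1] with κ_[j0,1](α j) = κ_L j
  CondI : (j0 : C) → UniquelyPaired (UpSet L j0) → Set
  CondI j0 upU =
      (∀ j → JI L j → _≤_ L j0 (κ j) → ∀ (a : BPoset.C (UpSet L j0)) →
         proj₁ a ≡ (j0 ∨ j) →
         JI (UpSet L j0) a × proj₁ (UniquelyPaired.κ upU a) ≡ κ j)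
    × (∀ j j' → JI L j → _≤_ L j0 (κ j) → JI L j' → _≤_ L j0 (κ j') →
         (j0 ∨ j) ≡ (j0 ∨ j') → j ≡ j')
    × (∀ (a : BPoset.C (UpSet L j0)) → JI (UpSet L j0) a →
         Σ C λ j → JI L j × _≤_ L j0 (κ j) × proj₁ a ≡ (j0 ∨ j))

  -- condition (ii): β(m) = m0 ∧ m is a bijection
  -- {m ∈ M_L : κ_L⁻¹ m ≤ m0} → M_[0,m0] with κ_[0,m0]⁻¹(β m) = κ_L⁻¹ m.
  -- Elements m ∈ M_L are written m = κ_L j with j ∈ J_L (so κ_L⁻¹ m = j).
  CondII : (m0 : C) → UniquelyPaired (DownSet L m0) → Set
  CondII m0 upD =
      (∀ j → JI L j → _≤_ L j m0 → ∀ (b : BPoset.C (DownSet L m0)) →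
         proj₁ b ≡ (m0 ⊓ κ j) →
         MI (DownSet L m0) b
         × Σ (BPoset.C (DownSet L m0)) λ d → proj₁ d ≡ j
             × JI (DownSet L m0) d × UniquelyPaired.κ upD d ≡ b)
    × (∀ j j' → JI L j → _≤_ L j m0 → JI L j' → _≤_ L j' m0 →
         (m0 ⊓ κ j) ≡ (m0 ⊓ κ j') → κ j ≡ κ j')
    × (∀ (b : BPoset.C (DownSet L m0)) → MI (DownSet L m0) b →
         Σ C λ j → JI L j × _≤_ L j m0 × proj₁ b ≡ (m0 ⊓ κ j))

data CD : (L : BPoset) → UniquelyPaired L → Set₁ where
  cd-single : ∀ {L} (up : UniquelyPaired L) →
              (∀ (x y : BPoset.C L) → x ≡ y) → CD L up
  cd-step : ∀ {L} (up : UniquelyPaired L) (j0 m0 : BPoset.C L) →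
            PrimePair L j0 m0 →
            (upU : UniquelyPaired (UpSet L j0)) → CD (UpSet L j0) upU →
            CondI L up j0 upU →
            (upD : UniquelyPaired (DownSet L m0)) → CD (DownSet L m0) upD →
            CondII L up m0 upD →
            CD L up

CompatiblyDismantlable : BPoset → Set₁
CompatiblyDismantlable L = Σ (UniquelyPaired L) (CD L)

module _ (L : BPoset) (up : UniquelyPaired L) where
  open BPoset L using (C)
  open UniquelyPaired up

  Edge : C → C → Set
  Edge j j' = j ≢ j' × ¬ (_≤_ L j (κ j'))

  InJx : C → C → Set
  InJx j x = JI L j × _≤_ L j x

  InMx : C → C → Set
  InMx j x = JI L j × _≤_ L x (κ j)

  -- D_L(x) = { j_{yx} : y ⋖ x } independent, where j_{yx} is the
  -- (unique) element of M_L(y) ∩ J_L(x)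
  DIndependent : Set
  DIndependent = ∀ x y y' → _⋖_ L y x → _⋖_ L y' x → ∀ j j' →
    InMx j y → InJx j x → InMx j' y' → InJx j' x → ¬ Edge j j'

  UIndependent : Set
  UIndependent = ∀ x y y' → _⋖_ L x y → _⋖_ L x y' → ∀ j j' →
    InMx j x → InJx j y → InMx j' x → InJx j' y' → ¬ Edge j j'

Semidistrim : BPoset → Set₁
Semidistrim L = Σ (CompatiblyDismantlable L) λ cd →
  DIndependent L (proj₁ cd) × UIndependent L (proj₁ cd)

{-# OPTIONS --safe #-}
module Submission where

-- Induction on the dismantling of L, for all intervals [u , v] at once. An interval
-- inside [j0 , 1] or [0 , m0] is handled by the smaller lattice; otherwise u ≤ m0 and
-- j0 ≤ v, and (u ∨ j0 , v ∧ m0) is a prime pair of [u , v]. Independence of 𝒟_L and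
-- 𝒰_L makes u ∨ j join-irreducible and v ∧ κ(j) meet-irreducible whenever u ≤ κ(j)
-- and j ≤ v: a cover of the interval crossing the prime pair carries the label j0,
-- which would be adjacent to j in the Galois graph. That u ∨ j ↦ v ∧ κ(j) is the only
-- pairing of [u , v] follows because another one, extended by κ, would be another
-- pairing of L.

open import Defs
open import Data.Bool using (Bool; T)
open import Data.Bool.Properties using (T?; T-irrelevant; T-∧)
open import Data.Empty using (⊥-elim)
open import Data.List using (List; []; _∷_)
open import Data.List.Membership.Propositional using (_∈_; lose)
open import Data.List.Relation.Unary.All using (all?; lookup; universal)
open import Data.List.Relation.Unary.Any using (any?; satisfied; here; there)
open import Data.Product using (Σ; _×_; _,_; proj₁; proj₂)
open import Data.Sum using (_⊎_; inj₁; inj₂)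
open import Data.Unit using (⊤; tt)
open import Function using (_∘_; flip)
open import Function.Bundles using (Equivalence)
open import Relation.Nullary using (¬_; Dec; yes; no; contradiction)
open import Relation.Nullary.Decidable using (map′; _×-dec_; _→-dec_; ¬?)
open import Relation.Binary.PropositionalEquality
  using (_≡_; _≢_; refl; sym; trans; cong; subst)

-- Extending a pairing of [u , v] to `L` works because matching passes back from the interval: if
-- `u ∨ j` and `v ∧ κ(j')` satisfy the pairing conditions in [u , v], then `j` and `κ(j')` satisfy
-- them in `L` (`matched-in-L`). Injectivity of `j ↦ u ∨ j` has the same source: two labels with the
-- same image could exchange their partners in `L`. Dismantlability of the two pieces alone would be
-- too weak an induction hypothesis, since conditions (i) and (ii) compare the pairing of [u , v]
-- with those of the pieces. All these pairings are therefore expressed by the same labels `j` of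
-- `L`, through `Corresponds`; conditions (i) and (ii) then say that labels are kept. A down-set
-- contains everything below its elements and an up-set everything above. Hence only lower covers in
-- the upper piece and upper covers in the lower piece can change on passing to [u , v]; these are
-- the two places where independence enters.

open BPoset using (C)

-- Maximal elements of finite lists and finiteness of subposets.

abstract
  -- Greedy scan: the candidate moves up to `h` when `h` satisfies `Q` and lies above it. A rejected
  -- `h` satisfying `Q` cannot lie above the final element, which is itself above the candidate.
  -- With `flip` the same lemma yields minimal elements.
  maximal : {A : Set} (_≼_ : A → A → Set) →
    (∀ {x} → x ≼ x) → (∀ {x y z} → x ≼ y → y ≼ z → x ≼ z) →
    (∀ x y → Dec (x ≼ y)) → (Q : A → Set) → (∀ x → Dec (Q x)) →
    (l : List A) → ∀ x → Q x →
    Σ A λ y → x ≼ y × Q y × (∀ z → z ∈ l → Q z → y ≼ z → z ≼ y)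
  maximal _≼_ rfl tr _≼?_ Q Q? [] x qx = x , rfl , qx , λ z ()
  maximal _≼_ rfl tr _≼?_ Q Q? (h ∷ l) x qx with Q? h ×-dec (x ≼? h)
  ... | yes (qh , x≼h) =
    let y , h≼y , qy , max = maximal _≼_ rfl tr _≼?_ Q Q? l h qh
    in y , tr x≼h h≼y , qy ,
       λ { z (here refl) _ _ → h≼y ; z (there z∈l) → max z z∈l }
  ... | no ¬p =
    let y , x≼y , qy , max = maximal _≼_ rfl tr _≼?_ Q Q? l x qx
    in y , x≼y , qy ,
       λ { z (here refl) qz y≼z → contradiction (qz , tr x≼y y≼z) ¬p
         ; z (there z∈l) → max z z∈l }

  finite-sub : (L : BPoset) (p : C L → Bool) → Finite L → Finite (Sub L p)
  finite-sub L p (l , complete) = restrict l , λ (x , px) → restrict-∈ l px (complete x)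
    where
    restrict : List (C L) → List (C (Sub L p))
    restrict [] = []
    restrict (x ∷ l) with T? (p x)
    ... | yes px = (x , px) ∷ restrict l
    ... | no _ = restrict l

    restrict-∈ : ∀ l {x} (px : T (p x)) → x ∈ l → (x , px) ∈ restrict l
    restrict-∈ (y ∷ l) px x∈ with T? (p y)
    restrict-∈ (y ∷ l) px (here refl) | yes py = here (cong (y ,_) (T-irrelevant px py))
    restrict-∈ (y ∷ l) px (there x∈) | yes _ = there (restrict-∈ l px x∈)
    restrict-∈ (y ∷ l) px (here refl) | no ¬py = contradiction px ¬py
    restrict-∈ (y ∷ l) px (there x∈) | no _ = restrict-∈ l px x∈

-- Irreducible elements, matched pairs and prime pairs.

module Order (L : BPoset) where

  infix 4 _⊑_ _⊑?_ _≟_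

  _⊑_ : C L → C L → Set
  _⊑_ = _≤_ L

  ⊑-refl : ∀ {x} → x ⊑ x
  ⊑-refl {x} = BPoset.≤-refl L x

  ⊑-reflexive : ∀ {x y} → x ≡ y → x ⊑ y
  ⊑-reflexive refl = ⊑-refl

  ⊑-trans : ∀ {x y z} → x ⊑ y → y ⊑ z → x ⊑ z
  ⊑-trans {x} {y} {z} = BPoset.≤-trans L x y z

  ⊑-antisym : ∀ {x y} → x ⊑ y → y ⊑ x → x ≡ y
  ⊑-antisym {x} {y} = BPoset.≤-antisym L x y

  _⊑?_ : ∀ x y → Dec (x ⊑ y)
  x ⊑? y = T? (BPoset._≤ᵇ_ L x y)

  _≟_ : (x y : C L) → Dec (x ≡ y)
  x ≟ y = map′ (λ (p , q) → ⊑-antisym p q)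
               (λ eq → ⊑-reflexive eq , ⊑-reflexive (sym eq))
               ((x ⊑? y) ×-dec (y ⊑? x))

  join-unique : ∀ {a b c d} → IsJoin L a b c → IsJoin L a b d → c ≡ d
  join-unique {c = c} {d} (a≤c , b≤c , c-least) (a≤d , b≤d , d-least) =
    ⊑-antisym (c-least d a≤d b≤d) (d-least c a≤c b≤c)

  meet-unique : ∀ {a b c d} → IsMeet L a b c → IsMeet L a b d → c ≡ d
  meet-unique {c = c} {d} (c≤a , c≤b , c-most) (d≤a , d≤b , d-most) =
    ⊑-antisym (d-most c c≤a c≤b) (c-most d d≤a d≤b)

  -- Join-irreducibility as it is used below: `s` is the greatest element strictly under `j`. This
  -- implies `JI` in every poset; the converse, `JI⇒lower`, rests on finiteness.
  Lower : C L → C L → Set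
  Lower j s = s ⊑ j × s ≢ j × (∀ x → x ⊑ j → x ≢ j → x ⊑ s)

  Upper : C L → C L → Set
  Upper m t = m ⊑ t × m ≢ t × (∀ x → m ⊑ x → m ≢ x → t ⊑ x)

  -- The conditions κ(j) ∈ M_L(j) and j ∈ J_L(κ(j)) together, in the self-dual
  -- form j_* ≤ m, j ≤ m^*, j ≰ m.
  record Matched (j m : C L) : Set where
    field
      lower upper : C L
      isLower : Lower j lower
      isUpper : Upper m upper
      lower⊑ : lower ⊑ m
      ⊑upper : j ⊑ upper
      ⋢ : ¬ j ⊑ m

  lower⇒cover : ∀ {j s} → Lower j s → _⋖_ L s j
  lower⇒cover {j} {s} (s≤ , s≢ , below) = s≤ , s≢ , between
    where
    between : ∀ z → s ⊑ z → z ⊑ j → (z ≡ s) ⊎ (z ≡ j)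
    between z s≤z z≤j with z ≟ j
    ... | yes z≡j = inj₂ z≡j
    ... | no z≢j = inj₁ (⊑-antisym (below z z≤j z≢j) s≤z)

  upper⇒cover : ∀ {m t} → Upper m t → _⋖_ L m t
  upper⇒cover {m} {t} (≤t , ≢t , above) = ≤t , ≢t , between
    where
    between : ∀ z → m ⊑ z → z ⊑ t → (z ≡ m) ⊎ (z ≡ t)
    between z m≤z z≤t with m ≟ z
    ... | yes m≡z = inj₁ (sym m≡z)
    ... | no m≢z = inj₂ (⊑-antisym z≤t (above z m≤z m≢z))

  lower⇒JI : ∀ {j s} → Lower j s → JI L j
  lower⇒JI {j} {s} low@(s≤ , s≢ , below) = s , lower⇒cover low , unique
    where
    unique : ∀ s' → _⋖_ L s' j → s' ≡ s
    unique s' (s'≤ , s'≢ , between) with between s (below s' s'≤ s'≢) s≤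
    ... | inj₁ s≡s' = sym s≡s'
    ... | inj₂ s≡j = contradiction s≡j s≢

  upper⇒MI : ∀ {m t} → Upper m t → MI L m
  upper⇒MI {m} {t} up@(≤t , ≢t , above) = t , upper⇒cover up , unique
    where
    unique : ∀ t' → _⋖_ L m t' → t' ≡ t
    unique t' (≤t' , ≢t' , between) with between t ≤t (above t' ≤t' ≢t')
    ... | inj₁ t≡m = contradiction (sym t≡m) ≢t
    ... | inj₂ t≡t' = sym t≡t'

  matched⇒JI : ∀ {j m} → Matched j m → JI L j
  matched⇒JI M = lower⇒JI (Matched.isLower M)

  matched⇒MI : ∀ {j m} → Matched j m → MI L m
  matched⇒MI M = upper⇒MI (Matched.isUpper M)

  module _ {j0 m0} (lat : IsLattice L) (prime : PrimePair L j0 m0) where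
    open IsLattice lat

    prime-⋢ : ¬ j0 ⊑ m0
    prime-⋢ j0≤m0 with prime j0
    ... | inj₁ (_ , j0≰j0) = j0≰j0 ⊑-refl
    ... | inj₂ (_ , j0≰m0) = j0≰m0 j0≤m0

    abstract
      -- An element below `j0` but not below `m0` lies above `j0`, hence equals it. So everything
      -- strictly below `j0` is below `j0 ⊓ m0`, and dually for `m0`.
      prime-matched : Matched j0 m0
      prime-matched = record
        { lower = j0 ⊓ m0
        ; upper = j0 ∨ m0
        ; isLower = meet≤j0 , (λ eq → prime-⋢ (⊑-trans (⊑-reflexive (sym eq)) meet≤m0)) , below
        ; isUpper = ≤join-m0 , (λ eq → prime-⋢ (⊑-trans ≤join-j0 (⊑-reflexive (sym eq)))) , above
        ; lower⊑ = meet≤m0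
        ; ⊑upper = ≤join-j0
        ; ⋢ = prime-⋢
        }
        where
        meet≤j0 : j0 ⊓ m0 ⊑ j0
        meet≤j0 = proj₁ (⊓-isMeet j0 m0)
        meet≤m0 : j0 ⊓ m0 ⊑ m0
        meet≤m0 = proj₁ (proj₂ (⊓-isMeet j0 m0))
        ≤join-j0 : j0 ⊑ j0 ∨ m0
        ≤join-j0 = proj₁ (∨-isJoin j0 m0)
        ≤join-m0 : m0 ⊑ j0 ∨ m0
        ≤join-m0 = proj₁ (proj₂ (∨-isJoin j0 m0))

        below : ∀ x → x ⊑ j0 → x ≢ j0 → x ⊑ j0 ⊓ m0
        below x x≤ x≢ with prime x
        ... | inj₁ (x≤m0 , _) = proj₂ (proj₂ (⊓-isMeet j0 m0)) x x≤ x≤m0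
        ... | inj₂ (j0≤x , _) = contradiction (⊑-antisym x≤ j0≤x) x≢

        above : ∀ x → m0 ⊑ x → m0 ≢ x → j0 ∨ m0 ⊑ x
        above x ≤x ≢x with prime x
        ... | inj₁ (x≤m0 , _) = contradiction (⊑-antisym ≤x x≤m0) ≢x
        ... | inj₂ (j0≤x , _) = proj₂ (proj₂ (∨-isJoin j0 m0)) x j0≤x ≤x

      -- If `j0` were strictly below `j`, then `j0` would lie below the lower cover of `j`, hence
      -- below `m` and `m0`.
      matched-across-prime : ∀ {j m} → Matched j m → j0 ⊑ j → m ⊑ m0 → j ≡ j0
      matched-across-prime {j} M j0≤j m≤m0 with j0 ≟ j
      ... | yes j0≡j = sym j0≡j
      ... | no j0≢j = contradiction
        (⊑-trans (proj₂ (proj₂ (Matched.isLower M)) j0 j0≤j j0≢j)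
                 (⊑-trans (Matched.lower⊑ M) m≤m0)) prime-⋢

  abstract
    -- Maximality in `InMset`: an element strictly above `κ j` lies above the upper cover of `κ j`,
    -- hence above `j`, so its meet with `j` is `j` and not the lower cover. Minimality in `InJset`
    -- is dual.
    toPairing : (κ : C L → C L) → (∀ j → JI L j → Matched j (κ j)) →
      (∀ j j' → JI L j → JI L j' → κ j ≡ κ j' → j ≡ j') →
      (∀ m → MI L m → Σ (C L) λ j → JI L j × κ j ≡ m) → Pairing L κ
    toPairing κ match inj surj = record
      { maps = maps ; inj = inj ; surj = surj ; inM = inM ; inJ = inJ }
      where
      open Matched
      maps : ∀ j → JI L j → MI L (κ j)
      maps j jj = matched⇒MI (match j jj)

      inM : ∀ j jj → InMset L j jj (κ j)
      inM j jj = (s≤j , subst (_⊑ κ j) s≡ (lower⊑ M) , greatest) , max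
        where
        M : Matched j (κ j)
        M = match j jj
        s : C L
        s = proj₁ jj
        s≡ : lower M ≡ s
        s≡ = proj₂ (proj₂ jj) (lower M) (lower⇒cover (isLower M))
        low : Lower j s
        low = subst (Lower j) s≡ (isLower M)
        s≤j : s ⊑ j
        s≤j = proj₁ low
        greatest : ∀ w → w ⊑ j → w ⊑ κ j → w ⊑ s
        greatest w w≤j w≤κ = proj₂ (proj₂ low) w w≤j λ { refl → ⋢ M w≤κ }
        max : ∀ z' → IsMeet L j z' s → κ j ⊑ z' → z' ≡ κ j
        max z' (_ , _ , most) κ≤z' with κ j ≟ z'
        ... | yes eq = sym eq
        ... | no neq = contradiction
          (⊑-antisym s≤j (most j ⊑-refl
            (⊑-trans (⊑upper M) (proj₂ (proj₂ (isUpper M)) z' κ≤z' neq))))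
          (proj₁ (proj₂ low))

      inJ : ∀ j jj → InJset L (κ j) (maps j jj) j
      inJ j jj = (proj₁ (isUpper M) , ⊑upper M , least) , min
        where
        M : Matched j (κ j)
        M = match j jj
        least : ∀ w → κ j ⊑ w → j ⊑ w → upper M ⊑ w
        least w κ≤w j≤w = proj₂ (proj₂ (isUpper M)) w κ≤w λ { refl → ⋢ M j≤w }
        min : ∀ z' → IsJoin L (κ j) z' (upper M) → z' ⊑ j → z' ≡ j
        min z' (_ , _ , most) z'≤j with z' ≟ j
        ... | yes eq = eq
        ... | no neq = contradiction
          (⊑-antisym (proj₁ (isUpper M)) (most (κ j) ⊑-refl
            (⊑-trans (proj₂ (proj₂ (isLower M)) z' z'≤j neq) (lower⊑ M))))
          (proj₁ (proj₂ (isUpper M)))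

-- Covers, irreducibility and bounds in a finite poset.

module FiniteOrder (L : BPoset) (fin : Finite L) where
  open Order L

  any-element? : {P : C L → Set} → (∀ x → Dec (P x)) → Dec (Σ (C L) P)
  any-element? P? = map′ satisfied (λ (x , px) → lose (proj₂ fin x) px) (any? P? (proj₁ fin))

  all-elements? : {P : C L → Set} → (∀ x → Dec (P x)) → Dec (∀ x → P x)
  all-elements? P? =
    map′ (λ ps x → lookup ps (proj₂ fin x)) (λ f → universal f _) (all? P? (proj₁ fin))

  abstract
    cover-above : ∀ {x y} → x ⊑ y → x ≢ y → Σ (C L) λ z → _⋖_ L x z × z ⊑ y
    cover-above {x} {y} x≤y x≢y
      with z , y≥z , (x≤z , x≢z) , min ← maximal (flip _⊑_) ⊑-refl (flip ⊑-trans) (flip _⊑?_)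
             (λ z → x ⊑ z × x ≢ z) (λ z → (x ⊑? z) ×-dec ¬? (x ≟ z)) (proj₁ fin) y (x≤y , x≢y)
      = z , (x≤z , x≢z , between) , y≥z
      where
      between : ∀ w → x ⊑ w → w ⊑ z → (w ≡ x) ⊎ (w ≡ z)
      between w x≤w w≤z with x ≟ w
      ... | yes x≡w = inj₁ (sym x≡w)
      ... | no x≢w = inj₂ (⊑-antisym w≤z (min w (proj₂ fin w) (x≤w , x≢w) w≤z))

    cover-below : ∀ {x y} → x ⊑ y → x ≢ y → Σ (C L) λ z → x ⊑ z × _⋖_ L z y
    cover-below {x} {y} x≤y x≢y
      with z , x≤z , (z≤y , z≢y) , max ← maximal _⊑_ ⊑-refl ⊑-trans _⊑?_
             (λ z → z ⊑ y × z ≢ y) (λ z → (z ⊑? y) ×-dec ¬? (z ≟ y)) (proj₁ fin) x (x≤y , x≢y)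
      = z , x≤z , z≤y , z≢y , between
      where
      between : ∀ w → z ⊑ w → w ⊑ y → (w ≡ z) ⊎ (w ≡ y)
      between w z≤w w≤y with w ≟ y
      ... | yes w≡y = inj₂ w≡y
      ... | no w≢y = inj₁ (⊑-antisym (max w (proj₂ fin w) (w≤y , w≢y) z≤w) z≤w)

  JI⇒lower : ∀ {j} (jj : JI L j) → Lower j (proj₁ jj)
  JI⇒lower {j} (s , (s≤j , s≢j , _) , unique) = s≤j , s≢j , below
    where
    below : ∀ x → x ⊑ j → x ≢ j → x ⊑ s
    below x x≤j x≢j with y , x≤y , y⋖j ← cover-below x≤j x≢j =
      subst (x ⊑_) (unique y y⋖j) x≤y

  MI⇒upper : ∀ {m} (mm : MI L m) → Upper m (proj₁ mm)
  MI⇒upper {m} (t , (m≤t , m≢t , _) , unique) = m≤t , m≢t , above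
    where
    above : ∀ x → m ⊑ x → m ≢ x → t ⊑ x
    above x m≤x m≢x with y , m⋖y , y≤x ← cover-above m≤x m≢x =
      subst (_⊑ x) (unique y m⋖y) y≤x

  abstract
    -- A pairing is a function on the whole carrier, so building a new one requires deciding where
    -- its value matters.
    JI? : ∀ j → Dec (JI L j)
    JI? j = map′ (λ (s , low) → lower⇒JI low) (λ jj → proj₁ jj , JI⇒lower jj)
      (any-element? λ s → (s ⊑? j) ×-dec ¬? (s ≟ j) ×-dec
        all-elements? λ x → (x ⊑? j) →-dec ¬? (x ≟ j) →-dec (x ⊑? s))

    pairing⇒matched : ∀ {κ} → Pairing L κ → ∀ j → JI L j → Matched j (κ j)
    pairing⇒matched {κ} pairing j jj = record
      { lower = proj₁ jj
      ; upper = proj₁ (maps j jj)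
      ; isLower = low
      ; isUpper = MI⇒upper (maps j jj)
      ; lower⊑ = proj₁ (proj₂ meet)
      ; ⊑upper = proj₁ (proj₂ (proj₁ (inJ j jj)))
      ; ⋢ = λ j≤κj → proj₁ (proj₂ low)
          (⊑-antisym (proj₁ low) (proj₂ (proj₂ meet) j ⊑-refl j≤κj))
      }
      where
      open Pairing pairing
      low : Lower j (proj₁ jj)
      low = JI⇒lower jj
      meet : IsMeet L j (κ j) (proj₁ jj)
      meet = proj₁ (inM j jj)

  module _ (lat : IsLattice L) where
    open IsLattice lat

    abstract
      top : C L → Σ (C L) λ t → ∀ x → x ⊑ t
      top a with t , _ , _ , max ← maximal _⊑_ ⊑-refl ⊑-trans _⊑?_
                   (λ _ → ⊤) (λ _ → yes tt) (proj₁ fin) a tt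
        = t , λ x → let t≤ , x≤ , _ = ∨-isJoin t x in
            ⊑-trans x≤ (max (t ∨ x) (proj₂ fin _) tt t≤)

      bottom : C L → Σ (C L) λ b → ∀ x → b ⊑ x
      bottom a with b , _ , _ , min ← maximal (flip _⊑_) ⊑-refl (flip ⊑-trans) (flip _⊑?_)
                   (λ _ → ⊤) (λ _ → yes tt) (proj₁ fin) a tt
        = b , λ x → let ≤b , ≤x , _ = ⊓-isMeet b x in
            ⊑-trans (min (b ⊓ x) (proj₂ fin _) tt ≤b) ≤x

-- Lattice structure and covers of an embedded interval.

-- I is order isomorphic to the interval [u , v] of L. Stating everything for such
-- an I makes the induction on CD applicable to iterated subposets as they are.
record Embeds (L I : BPoset) (u v : C L) (e : C I → C L) : Set where
  open Order L
  private module I = Order I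
  field
    mono : ∀ {i i'} → i I.⊑ i' → e i ⊑ e i'
    reflect : ∀ {i i'} → e i ⊑ e i' → i I.⊑ i'
    u⊑ : ∀ i → u ⊑ e i
    ⊑v : ∀ i → e i ⊑ v
    lift : ∀ x → u ⊑ x → x ⊑ v → Σ (C I) λ i → e i ≡ x

module Embedding {L I : BPoset} {u v : C L} {e : C I → C L}
                 (lat : IsLattice L) (E : Embeds L I u v e) where
  open Order L
  open IsLattice lat
  open Embeds E public
  private module I = Order I

  e-injective : ∀ {i i'} → e i ≡ e i' → i ≡ i'
  e-injective eq = I.⊑-antisym (reflect (⊑-reflexive eq)) (reflect (⊑-reflexive (sym eq)))

  abstract
    -- Only `a` has to lie in the interval. Typically `a` is `u` and `b` is a join-irreducible below
    -- `v` that need not be above `u`.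
    join-in : ∀ {a b} → u ⊑ a → a ⊑ v → b ⊑ v → Σ (C I) λ k → IsJoin L a b (e k)
    join-in {a} {b} u≤a a≤v b≤v with ∨-isJoin a b
    ... | join@(a≤ , _ , least) with lift (a ∨ b) (⊑-trans u≤a a≤) (least v a≤v b≤v)
    ...   | k , eq = k , subst (IsJoin L a b) (sym eq) join

    meet-in : ∀ {a b} → a ⊑ v → u ⊑ a → u ⊑ b → Σ (C I) λ k → IsMeet L a b (e k)
    meet-in {a} {b} a≤v u≤a u≤b with ⊓-isMeet a b
    ... | meet@(≤a , _ , most) with lift (a ⊓ b) (most u u≤a u≤b) (⊑-trans ≤a a≤v)
    ...   | k , eq = k , subst (IsMeet L a b) (sym eq) meet

  reflect-join : ∀ {a b c} → IsJoin L (e a) (e b) (e c) → IsJoin I a b c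
  reflect-join (a≤ , b≤ , least) =
    reflect a≤ , reflect b≤ , λ w a≤w b≤w → reflect (least (e w) (mono a≤w) (mono b≤w))

  reflect-meet : ∀ {a b c} → IsMeet L (e a) (e b) (e c) → IsMeet I a b c
  reflect-meet (≤a , ≤b , most) =
    reflect ≤a , reflect ≤b , λ w w≤a w≤b → reflect (most (e w) (mono w≤a) (mono w≤b))

  preserve-join : ∀ {a b c} → IsJoin I a b c → IsJoin L (e a) (e b) (e c)
  preserve-join {a} {b} join with k , joinL ← join-in (u⊑ a) (⊑v a) (⊑v b) =
    subst (IsJoin L (e a) (e b)) (cong e (I.join-unique (reflect-join joinL) join)) joinL

  preserve-meet : ∀ {a b c} → IsMeet I a b c → IsMeet L (e a) (e b) (e c)
  preserve-meet {a} {b} meet with k , meetL ← meet-in (⊑v a) (u⊑ a) (u⊑ b) =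
    subst (IsMeet L (e a) (e b)) (cong e (I.meet-unique (reflect-meet meetL) meet)) meetL

  lattice-in : IsLattice I
  lattice-in = record
    { _∨_ = λ a b → proj₁ (join-in (u⊑ a) (⊑v a) (⊑v b))
    ; _⊓_ = λ a b → proj₁ (meet-in (⊑v a) (u⊑ a) (u⊑ b))
    ; ∨-isJoin = λ a b → reflect-join (proj₂ (join-in (u⊑ a) (⊑v a) (⊑v b)))
    ; ⊓-isMeet = λ a b → reflect-meet (proj₂ (meet-in (⊑v a) (u⊑ a) (u⊑ b)))
    }

  preserve-cover : ∀ {x y} → _⋖_ I x y → _⋖_ L (e x) (e y)
  preserve-cover {x} {y} (x≤y , x≢y , between) = mono x≤y , x≢y ∘ e-injective , betweenL
    where
    betweenL : ∀ z → e x ⊑ z → z ⊑ e y → (z ≡ e x) ⊎ (z ≡ e y)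
    betweenL z x≤z z≤y with lift z (⊑-trans (u⊑ x) x≤z) (⊑-trans z≤y (⊑v y))
    ... | k , refl with between k (reflect x≤z) (reflect z≤y)
    ...   | inj₁ refl = inj₁ refl
    ...   | inj₂ refl = inj₂ refl

-- Correspondence of labels and its composition.

-- j ↦ u ∨ j is a bijection from {j : u ≤ κ(j), j ≤ v} onto the join-irreducibles
-- of I = [u , v], and κ_I(u ∨ j) = v ∧ κ(j).
record Corresponds (L : BPoset) (up : UniquelyPaired L) (I : BPoset) (upI : UniquelyPaired I)
                   (u v : C L) (e : C I → C L) : Set where
  open Order L
  open UniquelyPaired up using (κ)
  open UniquelyPaired upI using () renaming (κ to κI)
  field
    irreducible : ∀ {j} → JI L j → u ⊑ κ j → j ⊑ v → ∀ i → IsJoin L u j (e i) → JI I i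
    label : ∀ {j} → JI L j → u ⊑ κ j → j ⊑ v → ∀ i → IsJoin L u j (e i) →
      IsMeet L v (κ j) (e (κI i))
    onto : ∀ i → JI I i → Σ (C L) λ j → JI L j × u ⊑ κ j × j ⊑ v × IsJoin L u j (e i)
    injective : ∀ {j j'} → JI L j → u ⊑ κ j → j ⊑ v → JI L j' → u ⊑ κ j' → j' ⊑ v →
      ∀ i → IsJoin L u j (e i) → IsJoin L u j' (e i) → j ≡ j'

module _ {L K I : BPoset} {upL : UniquelyPaired L} {upK : UniquelyPaired K}
         {upI : UniquelyPaired I} {u₁ v₁ : C L} {u₂ v₂ : C K}
         {e₁ : C K → C L} {e₂ : C I → C K}
         (E₁ : Embeds L K u₁ v₁ e₁) (E₂ : Embeds K I u₂ v₂ e₂)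
         (C₁ : Corresponds L upL K upK u₁ v₁ e₁) (C₂ : Corresponds K upK I upI u₂ v₂ e₂)
         where
  open Order L
  open UniquelyPaired upL
  open UniquelyPaired upK using () renaming (κ to κK)
  open UniquelyPaired upI using () renaming (κ to κI)
  open Embedding lattice E₁
  open IsLattice lattice
  private
    module K = Order K
    module C₁ = Corresponds C₁
    module C₂ = Corresponds C₂

    restrict-join : ∀ {j x k} → u₁ ⊑ e₁ u₂ → IsJoin L u₁ j (e₁ k) → IsJoin L (e₁ u₂) j (e₁ x) →
      IsJoin K u₂ k x
    restrict-join u≤ (_ , j≤k , k-least) (u₂≤x , j≤x , least) =
      reflect u₂≤x , reflect (k-least _ (⊑-trans u≤ u₂≤x) j≤x) ,
      λ w u₂≤w k≤w → reflect (least (e₁ w) (mono u₂≤w) (⊑-trans j≤k (mono k≤w)))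

    lift-join : ∀ {j x k} → u₁ ⊑ e₁ u₂ → IsJoin L u₁ j (e₁ k) → IsJoin K u₂ k x →
      IsJoin L (e₁ u₂) j (e₁ x)
    lift-join {j} {x} {k} u≤ (_ , j≤k , k-least) (u₂≤x , k≤x , least) =
      mono u₂≤x , ⊑-trans j≤k (mono k≤x) , leastL
      where
      leastL : ∀ w → e₁ u₂ ⊑ w → j ⊑ w → e₁ x ⊑ w
      -- The bound `w` need not lie in `K`; its meet with `v₁` does, and is still above `u₂` and
      -- `k`.
      leastL w u₂≤w j≤w with meet-in ⊑-refl (⊑-trans (u⊑ u₂) (⊑v u₂)) (⊑-trans u≤ u₂≤w)
      ... | w' , _ , w'≤w , most = ⊑-trans (mono (least w'
        (reflect (most _ (⊑v u₂) u₂≤w))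
        (reflect (most _ (⊑v k) (k-least w (⊑-trans u≤ u₂≤w) j≤w))))) w'≤w

    lift-meet : ∀ {m x k} → u₁ ⊑ m → IsMeet L v₁ m (e₁ k) → IsMeet K v₂ k x →
      IsMeet L (e₁ v₂) m (e₁ x)
    lift-meet {m} {x} {k} u≤m (_ , k≤m , k-most) (x≤v₂ , x≤k , most) =
      mono x≤v₂ , ⊑-trans (mono x≤k) k≤m , mostL
      where
      mostL : ∀ w → w ⊑ e₁ v₂ → w ⊑ m → w ⊑ e₁ x
      mostL w w≤v₂ w≤m with join-in ⊑-refl (⊑-trans (u⊑ v₂) (⊑v v₂)) (⊑-trans w≤v₂ (⊑v v₂))
      ... | w' , _ , w≤w' , least = ⊑-trans w≤w' (mono (most w'
        (reflect (least _ (u⊑ v₂) w≤v₂))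
        (reflect (k-most _ (⊑v w') (least m u≤m w≤m)))))

    record Split (j : C L) : Set where
      field
        k : C K
        join : IsJoin L u₁ j (e₁ k)
        u≤κ : u₁ ⊑ κ j
        j≤v : j ⊑ v₁
        jiK : JI K k
        meet : IsMeet L v₁ (κ j) (e₁ (κK k))
        u₂≤κ : u₂ K.⊑ κK k
        k≤v₂ : k K.⊑ v₂

    split : ∀ {j} → JI L j → e₁ u₂ ⊑ κ j → j ⊑ e₁ v₂ → Split j
    split {j} jj u≤κ j≤v = record
      { k = k ; join = join ; u≤κ = u₁≤κ ; j≤v = j≤v₁ ; jiK = C₁.irreducible jj u₁≤κ j≤v₁ k join
      ; meet = meet
      ; u₂≤κ = reflect (proj₂ (proj₂ meet) _ (⊑v u₂) u≤κ)
      ; k≤v₂ = reflect (proj₂ (proj₂ join) _ (u⊑ v₂) j≤v)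
      }
      where
      u₁≤κ = ⊑-trans (u⊑ u₂) u≤κ
      j≤v₁ = ⊑-trans j≤v (⊑v v₂)
      kj = join-in ⊑-refl (⊑-trans (u⊑ u₂) (⊑v u₂)) j≤v₁
      k = proj₁ kj
      join = proj₂ kj
      meet = C₁.label jj u₁≤κ j≤v₁ k join

  -- Joining with `u₁` and then with `u₂ ≥ u₁` is joining with `u₂`, and dually for meets with `v₁`
  -- and `v₂`. A label `j` of `L` therefore passes to `I` through the label `u₁ ∨ j` of `K`.
  corresponds-trans : Corresponds L upL I upI (e₁ u₂) (e₁ v₂) (e₁ ∘ e₂)
  corresponds-trans = record
    { irreducible = λ jj u≤κ j≤v i isJ → let open Split (split jj u≤κ j≤v) in
        C₂.irreducible jiK u₂≤κ k≤v₂ i (restrict-join (u⊑ u₂) join isJ)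
    ; label = λ jj u≤κj j≤vj i isJ → let open Split (split jj u≤κj j≤vj) in
        lift-meet u≤κ meet (C₂.label jiK u₂≤κ k≤v₂ i (restrict-join (u⊑ u₂) join isJ))
    ; onto = ontoL
    ; injective = injectiveL
    }
    where
    ontoL : ∀ i → JI I i → Σ (C L) λ j →
      JI L j × e₁ u₂ ⊑ κ j × j ⊑ e₁ v₂ × IsJoin L (e₁ u₂) j (e₁ (e₂ i))
    ontoL i ji with C₂.onto i ji
    ... | k , jk , u₂≤κ , k≤v₂ , joinK with C₁.onto k jk
    ...   | j , jj , u₁≤κ , j≤v₁ , joinL =
      j , jj ,
      ⊑-trans (mono u₂≤κ) (proj₁ (proj₂ (C₁.label jj u₁≤κ j≤v₁ k joinL))) ,
      ⊑-trans (proj₁ (proj₂ joinL)) (mono k≤v₂) , lift-join (u⊑ u₂) joinL joinK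

    injectiveL : ∀ {j j'} → JI L j → e₁ u₂ ⊑ κ j → j ⊑ e₁ v₂ →
      JI L j' → e₁ u₂ ⊑ κ j' → j' ⊑ e₁ v₂ → ∀ i →
      IsJoin L (e₁ u₂) j (e₁ (e₂ i)) → IsJoin L (e₁ u₂) j' (e₁ (e₂ i)) → j ≡ j'
    injectiveL jj a b jj' a' b' i isJ isJ' =
      C₁.injective jj S.u≤κ S.j≤v jj' S'.u≤κ S'.j≤v S.k S.join
        (subst (λ k → IsJoin L u₁ _ (e₁ k)) (sym k≡k') S'.join)
      where
      module S = Split (split jj a b)
      module S' = Split (split jj' a' b')
      k≡k' : S.k ≡ S'.k
      k≡k' = C₂.injective S.jiK S.u₂≤κ S.k≤v₂ S'.jiK S'.u₂≤κ S'.k≤v₂ i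
        (restrict-join (u⊑ u₂) S.join isJ) (restrict-join (u⊑ u₂) S'.join isJ')

-- Inheritance of independence by intervals.

module _ {L I : BPoset} {up : UniquelyPaired L} {upI : UniquelyPaired I}
         {u v : C L} {e : C I → C L} (E : Embeds L I u v e)
         (corr : Corresponds L up I upI u v e) where
  open Order L
  open UniquelyPaired up
  open UniquelyPaired upI using () renaming (κ to κI)
  open Embedding lattice E
  open Corresponds corr
  private
    module I = Order I

    record Pulled (a : C I) : Set where
      field
        j : C L
        jj : JI L j
        join : IsJoin L u j (e a)
        meet : IsMeet L v (κ j) (e (κI a))

    pull : ∀ {a} → JI I a → Pulled a
    pull {a} ja with j , jj , u≤κ , j≤v , join ← onto a ja =
      record { j = j ; jj = jj ; join = join ; meet = label jj u≤κ j≤v a join }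

    -- Let `j`, `j'` be the labels of `a`, `b`. If `j ≤ κ(j')`, then `j ≤ v ∧ κ(j')`, which is the
    -- partner of `b` and lies above `u`; so `a = u ∨ j` is below it, and there is no edge in `I`.
    pull-edge : ∀ {a b} (ja : JI I a) (jb : JI I b) → Edge I upI a b →
      Edge L up (Pulled.j (pull ja)) (Pulled.j (pull jb))
    pull-edge {a} {b} ja jb (a≢b , a≰κb) = j≢ , j≰
      where
      module Pa = Pulled (pull ja)
      module Pb = Pulled (pull jb)
      j≢ : Pa.j ≢ Pb.j
      j≢ eq = a≢b (e-injective
        (join-unique Pa.join (subst (λ x → IsJoin L u x (e b)) (sym eq) Pb.join)))
      j≰ : ¬ Pa.j ⊑ κ Pb.j
      j≰ j≤κ = a≰κb (reflect (proj₂ (proj₂ Pa.join) _ (u⊑ _)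
        (proj₂ (proj₂ Pb.meet) _ (⊑-trans (proj₁ (proj₂ Pa.join)) (⊑v a)) j≤κ)))

    pull-M : ∀ {a x} (ja : JI I a) → x I.⊑ κI a → InMx L up (Pulled.j (pull ja)) (e x)
    pull-M ja x≤κ = Pulled.jj (pull ja) ,
      ⊑-trans (mono x≤κ) (proj₁ (proj₂ (Pulled.meet (pull ja))))

    pull-J : ∀ {a x} (ja : JI I a) → a I.⊑ x → InJx L up (Pulled.j (pull ja)) (e x)
    pull-J ja a≤x = Pulled.jj (pull ja) ,
      ⊑-trans (proj₁ (proj₂ (Pulled.join (pull ja)))) (mono a≤x)

  -- Intervals are convex, so covers of `I` are covers of `L`, and an edge between labels in `I`
  -- pulls back to one in `L`. Besides the conclusion of the theorem, this supplies the hypotheses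
  -- of the recursive calls in `dismantle`.
  transfer-D : DIndependent L up → DIndependent I upI
  transfer-D ind x y y' y⋖x y'⋖x a b (ja , y≤κ) (_ , a≤x) (jb , y'≤κ) (_ , b≤x) edge =
    ind (e x) (e y) (e y') (preserve-cover y⋖x) (preserve-cover y'⋖x) _ _
      (pull-M ja y≤κ) (pull-J ja a≤x) (pull-M jb y'≤κ) (pull-J jb b≤x) (pull-edge ja jb edge)

  transfer-U : UIndependent L up → UIndependent I upI
  transfer-U ind x y y' x⋖y x⋖y' a b (ja , x≤κ) (_ , a≤y) (jb , x≤κ') (_ , b≤y') edge =
    ind (e x) (e y) (e y') (preserve-cover x⋖y) (preserve-cover x⋖y') _ _
      (pull-M ja x≤κ) (pull-J ja a≤y) (pull-M jb x≤κ') (pull-J jb b≤y') (pull-edge ja jb edge)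

-- Rigidity of a unique pairing.

module _ {L : BPoset} (fin : Finite L) (up : UniquelyPaired L) where
  open UniquelyPaired up
  open Pairing pairing
  open Order L
  open FiniteOrder L fin

  abstract
    matched : ∀ j → JI L j → Matched j (κ j)
    matched = pairing⇒matched pairing

  -- Reindexing κ along R gives another pairing, so R is the identity.
  abstract
    rigid : (R : C L → C L → Set) →
      (∀ j → JI L j → Σ (C L) λ k → JI L k × R j k) →
      (∀ k → JI L k → Σ (C L) λ j → JI L j × R j k) →
      (∀ {j k k'} → R j k → R j k' → k ≡ k') →
      (∀ {j j' k} → R j k → R j' k → j ≡ j') →
      (∀ {j k} → JI L j → JI L k → R j k → Matched j (κ k)) →
      ∀ {j k} → JI L j → R j k → j ≡ k
    rigid R total surjective functional injective match {j} jj Rjk =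
      -- Uniqueness of the pairing gives `κ (σ j) ≡ κ j`, hence `σ j ≡ j`, while `k ≡ σ j` by
      -- functionality.
      sym (trans (functional Rjk Rσ)
        (inj _ _ jσ jj (unique (κ ∘ σ) pairing' j jj)))
      where
      -- Off the join-irreducibles the value `j` is an arbitrary default.
      choose : ∀ j → Σ (C L) λ k → JI L j → JI L k × R j k
      choose j with JI? j
      ... | yes jj = proj₁ (total j jj) , λ _ → proj₂ (total j jj)
      ... | no ¬jj = j , λ jj → contradiction jj ¬jj

      σ : C L → C L
      σ j = proj₁ (choose j)

      σ-spec : ∀ j → JI L j → JI L (σ j) × R j (σ j)
      σ-spec j = proj₂ (choose j)

      jσ : JI L (σ j)
      jσ = proj₁ (σ-spec j jj)
      Rσ : R j (σ j)
      Rσ = proj₂ (σ-spec j jj)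

      inj' : ∀ j j' → JI L j → JI L j' → κ (σ j) ≡ κ (σ j') → j ≡ j'
      inj' j j' jj jj' eq =
        let js , Rs = σ-spec j jj
            js' , Rs' = σ-spec j' jj'
        in injective Rs (subst (R j') (sym (inj _ _ js js' eq)) Rs')

      surj' : ∀ m → MI L m → Σ (C L) λ j → JI L j × κ (σ j) ≡ m
      surj' m mm with surj m mm
      ... | k , jk , eq with surjective k jk
      ...   | j , jj , Rjk = j , jj , trans (cong κ (functional (proj₂ (σ-spec j jj)) Rjk)) eq

      pairing' : Pairing L (κ ∘ σ)
      pairing' = toPairing (κ ∘ σ)
        (λ j jj → let js , Rs = σ-spec j jj in match jj js Rs) inj' surj'

  -- For distinct `a` and `b`, swapping their partners and keeping `κ` elsewhere would be a second
  -- pairing.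
  no-exchange : ∀ {a b} → JI L a → JI L b → Matched a (κ b) → Matched b (κ a) → a ≡ b
  no-exchange {a} {b} ja jb Mab Mba with a ≟ b
  ... | yes a≡b = a≡b
  ... | no a≢b = rigid R total (λ k jk → let j , jj , Rkj = total k jk in j , jj , R-sym Rkj)
      functional (λ Rjk Rj'k → functional (R-sym Rjk) (R-sym Rj'k)) match ja (inj₁ (refl , refl))
    where
    R : C L → C L → Set
    R x y = (x ≡ a × y ≡ b) ⊎ (x ≡ b × y ≡ a) ⊎ (x ≢ a × x ≢ b × x ≡ y)

    R-sym : ∀ {x y} → R x y → R y x
    R-sym (inj₁ (p , q)) = inj₂ (inj₁ (q , p))
    R-sym (inj₂ (inj₁ (p , q))) = inj₁ (q , p)
    R-sym (inj₂ (inj₂ (p , q , refl))) = inj₂ (inj₂ (p , q , refl))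

    total : ∀ j → JI L j → Σ (C L) λ k → JI L k × R j k
    total j jj with j ≟ a | j ≟ b
    ... | yes j≡a | _ = b , jb , inj₁ (j≡a , refl)
    ... | no _ | yes j≡b = a , ja , inj₂ (inj₁ (j≡b , refl))
    ... | no j≢a | no j≢b = j , jj , inj₂ (inj₂ (j≢a , j≢b , refl))

    functional : ∀ {j k k'} → R j k → R j k' → k ≡ k'
    functional (inj₁ (_ , p)) (inj₁ (_ , q)) = trans p (sym q)
    functional (inj₁ (p , _)) (inj₂ (inj₁ (q , _))) = contradiction (trans (sym p) q) a≢b
    functional (inj₁ (p , _)) (inj₂ (inj₂ (q , _))) = contradiction p q
    functional (inj₂ (inj₁ (p , _))) (inj₁ (q , _)) = contradiction (trans (sym q) p) a≢b
    functional (inj₂ (inj₁ (_ , p))) (inj₂ (inj₁ (_ , q))) = trans p (sym q)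
    functional (inj₂ (inj₁ (p , _))) (inj₂ (inj₂ (_ , q , _))) = contradiction p q
    functional (inj₂ (inj₂ (p , _))) (inj₁ (q , _)) = contradiction q p
    functional (inj₂ (inj₂ (_ , p , _))) (inj₂ (inj₁ (q , _))) = contradiction q p
    functional (inj₂ (inj₂ (_ , _ , p))) (inj₂ (inj₂ (_ , _ , q))) = trans (sym p) q

    match : ∀ {j k} → JI L j → JI L k → R j k → Matched j (κ k)
    match _ _ (inj₁ (refl , refl)) = Mab
    match _ _ (inj₂ (inj₁ (refl , refl))) = Mba
    match {j} jj _ (inj₂ (inj₂ (_ , _ , refl))) = matched j jj

-- The unique pairing of an interval, given that labels produce matched pairs and reach all
-- irreducibles.

module IntervalPairing
  {L I : BPoset} (fin : Finite L) (up : UniquelyPaired L) (finI : Finite I)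
  {u v : C L} {e : C I → C L} (u⊑v : _≤_ L u v) (E : Embeds L I u v e)
  (match : ∀ {j} → JI L j → _≤_ L u (UniquelyPaired.κ up j) → _≤_ L j v →
     ∀ {i m} → IsJoin L u j (e i) → IsMeet L v (UniquelyPaired.κ up j) (e m) →
     Order.Matched I i m)
  (ontoJ : ∀ i → JI I i → Σ (C L) λ j →
     JI L j × _≤_ L u (UniquelyPaired.κ up j) × _≤_ L j v × IsJoin L u j (e i))
  (ontoM : ∀ m → MI I m → Σ (C L) λ j →
     JI L j × _≤_ L u (UniquelyPaired.κ up j) × _≤_ L j v ×
     IsMeet L v (UniquelyPaired.κ up j) (e m))
  where
  open UniquelyPaired up
  open Order L
  open FiniteOrder L fin using (any-element?; JI?)
  open Embedding lattice E
  private
    module I = Order I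
    module FI = FiniteOrder I finI

  Window : C L → Set
  Window j = u ⊑ κ j × j ⊑ v

  window? : ∀ j → Dec (Window j)
  window? j = (u ⊑? κ j) ×-dec (j ⊑? v)

  join-of : ∀ {j} → Window j → Σ (C I) λ i → IsJoin L u j (e i)
  join-of (_ , j≤v) = join-in ⊑-refl u⊑v j≤v

  meet-of : ∀ {j} → Window j → Σ (C I) λ m → IsMeet L v (κ j) (e m)
  meet-of (u≤κ , _) = meet-in ⊑-refl u⊑v u≤κ

  match' : ∀ {j} → JI L j → Window j →
    ∀ {i m} → IsJoin L u j (e i) → IsMeet L v (κ j) (e m) → I.Matched i m
  match' jj (u≤κ , j≤v) = match jj u≤κ j≤v

  abstract
    -- Let `s` be the lower cover of `j`. Then `u ∨ s` lies below `κ(j)` but `j` does not, so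
    -- `u ∨ s` is strictly below `u ∨ j`, hence below its lower cover in `I` and so below
    -- `v ∧ κ(j')`. This gives `s ≤ κ(j')`; the bound on `j` by the upper cover of `κ(j')` is dual.
    matched-in-L : ∀ {j j'} → JI L j → Window j → JI L j' → Window j' →
      ∀ {i m} → IsJoin L u j (e i) → IsMeet L v (κ j') (e m) → I.Matched i m →
      Matched j (κ j')
    matched-in-L {j} {j'} jj (u≤κ , j≤v) jj' (u≤κ' , j'≤v) {i} {m}
                 (_ , j≤i , i-least) (_ , m≤κ' , m-most) P = record
      { lower = M.lower
      ; upper = M'.upper
      ; isLower = M.isLower
      ; isUpper = M'.isUpper
      ; lower⊑ = lower≤
      ; ⊑upper = ≤upper
      ; ⋢ = λ j≤κ' → P.⋢ (reflect (i-least _ (u⊑ m) (m-most j j≤v j≤κ')))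
      }
      where
      module M = Matched (matched fin up j jj)
      module M' = Matched (matched fin up j' jj')
      module P = I.Matched P

      lower≤ : M.lower ⊑ κ j'
      lower≤ with join-in ⊑-refl u⊑v (⊑-trans (proj₁ M.isLower) j≤v)
      ... | k , u≤k , s≤k , least =
        ⊑-trans s≤k (⊑-trans (mono (I.⊑-trans (proj₂ (proj₂ P.isLower) k k≤i k≢i) P.lower⊑)) m≤κ')
        where
        k≤i : k I.⊑ i
        k≤i = reflect (least _ (u⊑ i) (⊑-trans (proj₁ M.isLower) j≤i))
        k≢i : k ≢ i
        k≢i refl = M.⋢ (⊑-trans j≤i (least _ u≤κ M.lower⊑))

      ≤upper : j ⊑ M'.upper
      ≤upper with meet-in ⊑-refl u⊑v (⊑-trans u≤κ' (proj₁ M'.isUpper))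
      ... | k , k≤v , k≤t , most =
        ⊑-trans j≤i (⊑-trans (mono (I.⊑-trans P.⊑upper (proj₂ (proj₂ P.isUpper) k m≤k m≢k))) k≤t)
        where
        m≤k : m I.⊑ k
        m≤k = reflect (most _ (⊑v m) (⊑-trans m≤κ' (proj₁ M'.isUpper)))
        m≢k : m ≢ k
        m≢k refl = M'.⋢ (⊑-trans (most j' j'≤v M'.⊑upper) m≤κ')

    -- The common join is matched in `I` with both `v ∧ κ(j)` and `v ∧ κ(j')`. Back in `L`, `j`
    -- matches `κ(j')` and `j'` matches `κ(j)`, which `no-exchange` excludes for distinct labels.
    join-injective : ∀ {j j'} → JI L j → Window j → JI L j' → Window j' →
      ∀ {i} → IsJoin L u j (e i) → IsJoin L u j' (e i) → j ≡ j'
    join-injective jj w jj' w' is-i is-i' with meet-of w | meet-of w'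
    ... | m , is-m | m' , is-m' = no-exchange fin up jj jj'
      (matched-in-L jj w jj' w' is-i is-m' (match' jj' w' is-i' is-m'))
      (matched-in-L jj' w' jj w is-i' is-m (match' jj w is-i is-m))

    meet-injective : ∀ {j j'} → JI L j → Window j → JI L j' → Window j' →
      ∀ {m} → IsMeet L v (κ j) (e m) → IsMeet L v (κ j') (e m) → j ≡ j'
    meet-injective jj w jj' w' is-m is-m' with join-of w | join-of w'
    ... | i , is-i | i' , is-i' = no-exchange fin up jj jj'
      (matched-in-L jj w jj' w' is-i is-m' (match' jj w is-i is-m))
      (matched-in-L jj' w' jj w is-i' is-m (match' jj' w' is-i' is-m'))

    label? : ∀ i → Dec (Σ (C L) λ j → JI L j × Window j × IsLattice._∨_ lattice u j ≡ e i)
    label? i = any-element? λ j → JI? j ×-dec window? j ×-dec (_ ≟ e i)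

  isJoin⇒≡ : ∀ {j x} → IsJoin L u j x → IsLattice._∨_ lattice u j ≡ x
  isJoin⇒≡ = join-unique (IsLattice.∨-isJoin lattice _ _)

  abstract
    partner : ∀ i → Σ (C I) λ m →
      ∀ {j} → JI L j → Window j → IsJoin L u j (e i) → IsMeet L v (κ j) (e m)
    partner i with label? i
    -- An element without a label gets the default `i`; the property then holds vacuously.
    ... | no ¬l = i , λ jj w is-i → contradiction (_ , jj , w , isJoin⇒≡ is-i) ¬l
    ... | yes (j' , jj' , w' , eq) = proj₁ (meet-of w') , λ jj w is-i →
      subst (λ x → IsMeet L v (κ x) (e (proj₁ (meet-of w'))))
        (join-injective jj' w' jj w
          (subst (IsJoin L u j') eq (IsLattice.∨-isJoin lattice u j')) is-i)
        (proj₂ (meet-of w'))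

  κI : C I → C I
  κI i = proj₁ (partner i)

  κI-spec : ∀ {j} → JI L j → Window j → ∀ {i} → IsJoin L u j (e i) → IsMeet L v (κ j) (e (κI i))
  κI-spec jj w {i} = proj₂ (partner i) jj w

  pairingI : Pairing I κI
  pairingI = I.toPairing κI matchI injI surjI
    where
    matchI : ∀ i → JI I i → I.Matched i (κI i)
    matchI i ji with j , jj , a , b , is-i ← ontoJ i ji =
      match jj a b is-i (κI-spec jj (a , b) is-i)

    injI : ∀ i i' → JI I i → JI I i' → κI i ≡ κI i' → i ≡ i'
    injI i i' ji ji' eq with ontoJ i ji | ontoJ i' ji'
    ... | j , jj , a , b , is-i | j' , jj' , a' , b' , is-i'
      with refl ← meet-injective jj (a , b) jj' (a' , b') (κI-spec jj (a , b) is-i)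
        (subst (λ m → IsMeet L v (κ j') (e m)) (sym eq) (κI-spec jj' (a' , b') is-i'))
      = e-injective (join-unique is-i is-i')

    surjI : ∀ m → MI I m → Σ (C I) λ i → JI I i × κI i ≡ m
    surjI m mm with ontoM m mm
    ... | j , jj , a , b , is-m with join-of (a , b)
    ...   | i , is-i = i , I.matched⇒JI (match jj a b is-i is-m) ,
      e-injective (meet-unique (κI-spec jj (a , b) is-i) is-m)

  module _ (κ' : C I → C I) (pairing' : Pairing I κ') where
    private module P' = Pairing pairing'

    -- `κ'` read through labels: it sends `u ∨ j` to `v ∧ κ(k)`, so in `L` the new partner of `j` is
    -- to be `κ(k)`.
    Moved : C L → C L → Set
    Moved j k = JI L j × Window j × JI L k × Window k ×
      Σ (C I) λ i → JI I i × IsJoin L u j (e i) × IsMeet L v (κ k) (e (κ' i))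

    -- The pairing of L that follows κ' inside the window and κ outside.
    Extended : C L → C L → Set
    Extended j k = Moved j k ⊎ (¬ Window j × j ≡ k)

    functional : ∀ {j k k'} → Extended j k → Extended j k' → k ≡ k'
    functional (inj₁ (_ , _ , jk , wk , i , _ , is-i , is-m))
               (inj₁ (_ , _ , jk' , wk' , i' , _ , is-i' , is-m'))
      with refl ← e-injective {i} {i'} (join-unique is-i is-i') = meet-injective jk wk jk' wk' is-m is-m'
    functional (inj₁ (_ , w , _)) (inj₂ (¬w , _)) = contradiction w ¬w
    functional (inj₂ (¬w , _)) (inj₁ (_ , w , _)) = contradiction w ¬w
    functional (inj₂ (_ , p)) (inj₂ (_ , q)) = trans (sym p) q

    injective : ∀ {j j' k} → Extended j k → Extended j' k → j ≡ j'
    injective (inj₁ (jj , w , _ , _ , i , ji , is-i , is-m))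
              (inj₁ (jj' , w' , _ , _ , i' , ji' , is-i' , is-m'))
      with refl ← P'.inj i i' ji ji' (e-injective (meet-unique is-m is-m')) =
      join-injective jj w jj' w' is-i is-i'
    injective (inj₁ (_ , _ , _ , w , _)) (inj₂ (¬w , refl)) = contradiction w ¬w
    injective (inj₂ (¬w , refl)) (inj₁ (_ , _ , _ , w , _)) = contradiction w ¬w
    injective (inj₂ (_ , p)) (inj₂ (_ , q)) = trans p (sym q)

    total : ∀ j → JI L j → Σ (C L) λ k → JI L k × Extended j k
    total j jj with window? j
    ... | no ¬w = j , jj , inj₂ (¬w , refl)
    ... | yes w@(a , b) with join-of w | meet-of w
    ...   | i , is-i | m , is-m = k , jk , inj₁ (jj , w , jk , wk , i , ji , is-i , is-m')
      where
      ji = I.matched⇒JI (match jj a b is-i is-m)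
      target = ontoM (κ' i) (P'.maps i ji)
      k = proj₁ target
      jk = proj₁ (proj₂ target)
      wk = proj₁ (proj₂ (proj₂ target)) , proj₁ (proj₂ (proj₂ (proj₂ target)))
      is-m' = proj₂ (proj₂ (proj₂ (proj₂ target)))

    surjective : ∀ k → JI L k → Σ (C L) λ j → JI L j × Extended j k
    surjective k jk with window? k
    ... | no ¬w = k , jk , inj₂ (¬w , refl)
    ... | yes w@(a , b) with join-of w | meet-of w
    ...   | i , is-i | m , is-m with P'.surj m (I.matched⇒MI (match jk a b is-i is-m))
    ...     | i' , ji' , refl with ontoJ i' ji'
    ...       | j , jj , a' , b' , is-i' =
      j , jj , inj₁ (jj , (a' , b') , jk , w , i' , ji' , is-i' , is-m)

    extended-matched : ∀ {j k} → JI L j → JI L k → Extended j k → Matched j (κ k)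
    extended-matched _ _ (inj₁ (jj , w , jk , wk , i , ji , is-i , is-m)) =
      matched-in-L jj w jk wk is-i is-m (FI.pairing⇒matched pairing' i ji)
    extended-matched jj _ (inj₂ (_ , refl)) = matched fin up _ jj

    uniqueI : ∀ i → JI I i → κ' i ≡ κI i
    uniqueI i ji with ontoJ i ji
    ... | j , jj , a , b , is-i with ontoM (κ' i) (P'.maps i ji)
    ...   | k , jk , a' , b' , is-m
      -- Rigidity forces `k` to be `j`, so `κ'` sends `u ∨ j` to `v ∧ κ(j)`, as `κI` does.
      with refl ← rigid fin up Extended total surjective functional injective extended-matched jj
             (inj₁ (jj , (a , b) , jk , (a' , b') , i , ji , is-i , is-m))
      = e-injective (meet-unique is-m (κI-spec jj (a , b) is-i))

  upI : UniquelyPaired I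
  upI = record { lattice = lattice-in ; κ = κI ; pairing = pairingI ; unique = uniqueI }

  corresponds : Corresponds L up I upI u v e
  corresponds = record
    { irreducible = λ jj a b i is-i →
        I.matched⇒JI (match jj a b is-i (κI-spec jj (a , b) is-i))
    ; label = λ jj a b i is-i → κI-spec jj (a , b) is-i
    ; onto = ontoJ
    ; injective = λ jj a b jj' a' b' i is-i is-i' → join-injective jj (a , b) jj' (a' , b') is-i is-i'
    }

-- Up-sets and down-sets as intervals; conditions (i) and (ii) as correspondences.

module _ {L : BPoset} (lat : IsLattice L) where
  open Order L

  embeds-up : ∀ {j0 t} → (∀ x → x ⊑ t) → Embeds L (UpSet L j0) j0 t proj₁
  embeds-up ≤t = record
    { mono = λ p → p ; reflect = λ p → p ; u⊑ = proj₂ ; ⊑v = λ x → ≤t (proj₁ x)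
    ; lift = λ x p _ → (x , p) , refl }

  embeds-down : ∀ {b m0} → (∀ x → b ⊑ x) → Embeds L (DownSet L m0) b m0 proj₁
  embeds-down b≤ = record
    { mono = λ p → p ; reflect = λ p → p ; u⊑ = λ x → b≤ (proj₁ x) ; ⊑v = proj₂
    ; lift = λ x _ q → (x , q) , refl }

module _ {L I : BPoset} {u v : C L} {e : C I → C L} (E : Embeds L I u v e) where
  open Embeds E
  open Order L
  private module I = Order I

  abstract
    embeds-in-sub : {p : C L → Bool} (pu : T (p u)) (pv : T (p v)) (pe : ∀ i → T (p (e i))) →
      Embeds (Sub L p) I (u , pu) (v , pv) (λ i → e i , pe i)
    embeds-in-sub {p} pu pv pe = record
      { mono = mono ; reflect = reflect ; u⊑ = u⊑ ; ⊑v = ⊑v ; lift = lift' }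
      where
      lift' : (x : C (Sub L p)) → u ⊑ proj₁ x → proj₁ x ⊑ v →
        Σ (C I) λ i → _≡_ {A = C (Sub L p)} (e i , pe i) x
      lift' (x , px) u≤x x≤v with lift x u≤x x≤v
      ... | i , refl = i , cong (e i ,_) (T-irrelevant (pe i) px)

    up-embeds : ∀ i0 → Embeds L (UpSet I i0) (e i0) v (e ∘ proj₁)
    up-embeds i0 = record
      { mono = mono ; reflect = reflect ; u⊑ = λ x → mono (proj₂ x) ; ⊑v = λ x → ⊑v (proj₁ x)
      ; lift = lift' }
      where
      lift' : ∀ x → e i0 ⊑ x → x ⊑ v → Σ (C (UpSet I i0)) λ i → e (proj₁ i) ≡ x
      lift' x i0≤x x≤v with lift x (⊑-trans (u⊑ i0) i0≤x) x≤v
      ... | i , refl = (i , reflect i0≤x) , refl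

    down-embeds : ∀ n0 → Embeds L (DownSet I n0) u (e n0) (e ∘ proj₁)
    down-embeds n0 = record
      { mono = mono ; reflect = reflect ; u⊑ = λ x → u⊑ (proj₁ x) ; ⊑v = λ x → mono (proj₂ x)
      ; lift = lift' }
      where
      lift' : ∀ x → u ⊑ x → x ⊑ e n0 → Σ (C (DownSet I n0)) λ i → e (proj₁ i) ≡ x
      lift' x u≤x x≤n0 with lift x u≤x (⊑-trans x≤n0 (⊑v n0))
      ... | i , refl = (i , reflect x≤n0) , refl

interval-embeds : (L : BPoset) (u v : C L) → Embeds L (Interval L u v) u v proj₁
interval-embeds L u v = record
  { mono = λ p → p ; reflect = λ p → p
  ; u⊑ = λ (x , p) → proj₁ (to x p)
  ; ⊑v = λ (x , p) → proj₂ (to x p)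
  ; lift = λ x p q → (x , from x (p , q)) , refl }
  where
  open BPoset L using (_≤ᵇ_)
  open module ∧-split x = Equivalence (T-∧ {u ≤ᵇ x} {x ≤ᵇ v}) using (to; from)

module _ {L : BPoset} (fin : Finite L) (up : UniquelyPaired L) where
  open Order L
  open UniquelyPaired up
  open IsLattice lattice

  -- With `v` the top element, `v ∧ κ(j)` is `κ(j)` and `j ≤ v` always holds, so condition (i) is
  -- the correspondence itself.
  corresponds-up : ∀ {j0 t} {upU : UniquelyPaired (UpSet L j0)} → (∀ x → x ⊑ t) →
    CondI L up j0 upU → Corresponds L up (UpSet L j0) upU j0 t proj₁
  corresponds-up {j0} {t} {upU} ≤t (α , α-inj , α-surj) = record
    { irreducible = λ jj a _ i is-i → proj₁ (α _ jj a i (≡join is-i))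
    ; label = λ {j} jj a _ i is-i → subst (IsMeet L t (κ j))
        (sym (proj₂ (α _ jj a i (≡join is-i)))) (≤t _ , ⊑-refl , λ _ _ p → p)
    ; onto = λ i ji → let j , jj , a , eq = α-surj i ji in
        j , jj , a , ≤t j , subst (IsJoin L j0 j) (sym eq) (∨-isJoin j0 j)
    ; injective = λ jj a _ jj' a' _ i is-i is-i' →
        α-inj _ _ jj a jj' a' (trans (sym (≡join is-i)) (≡join is-i'))
    }
    where
    ≡join : ∀ {j x} → IsJoin L j0 j x → x ≡ j0 ∨ j
    ≡join is-x = join-unique is-x (∨-isJoin _ _)

  -- With `u` the bottom element, `u ∨ j` is `j`: labels are the join-irreducibles of the down-set,
  -- which are join-irreducible in `L` too, and condition (ii) supplies their partners.
  corresponds-down : ∀ {b m0} {upD : UniquelyPaired (DownSet L m0)} → (∀ x → b ⊑ x) →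
    CondII L up m0 upD → Corresponds L up (DownSet L m0) upD b m0 proj₁
  corresponds-down {b} {m0} {upD} b≤ (β , _) = record
    { irreducible = λ jj _ j≤m0 i is-i → proj₁ (irreducible-label jj j≤m0 i is-i)
    ; label = λ jj _ j≤m0 i is-i → proj₂ (irreducible-label jj j≤m0 i is-i)
    ; onto = λ (x , x≤m0) jx → x , JI-down jx , b≤ _ , x≤m0 , b≤ x , ⊑-refl , λ _ _ p → p
    ; injective = λ _ _ _ _ _ _ i is-i is-i' → trans (sym (≡j is-i)) (≡j is-i')
    }
    where
    D = DownSet L m0
    module D = Order D
    module FD = FiniteOrder D (finite-sub L _ fin)
    open UniquelyPaired upD using () renaming (κ to κD)

    ≡j : ∀ {j x} → IsJoin L b j x → x ≡ j
    ≡j is-x = join-unique is-x (b≤ _ , ⊑-refl , λ _ _ p → p)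

    abstract
      irreducible-label : ∀ {j} → JI L j → j ⊑ m0 → ∀ i → IsJoin L b j (proj₁ i) →
        JI D i × IsMeet L m0 (κ j) (proj₁ (κD i))
      irreducible-label {j} jj j≤m0 i is-i
        with β j jj j≤m0 (m0 ⊓ κ j , proj₁ (⊓-isMeet m0 (κ j))) refl
      ... | _ , d , d≡j , jd , κd
        with refl ← D.⊑-antisym {d} {i} (⊑-reflexive (trans d≡j (sym (≡j is-i))))
                      (⊑-reflexive (trans (≡j is-i) (sym d≡j)))
        = jd , subst (IsMeet L m0 (κ j)) (sym (cong proj₁ κd)) (⊓-isMeet m0 (κ j))

    JI-down : ∀ {x} → JI D x → JI L (proj₁ x)
    JI-down {x , x≤m0} jx with FD.JI⇒lower jx
    ... | s≤ , s≢ , below = lower⇒JI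
      ( s≤
      , (λ eq → s≢ (D.⊑-antisym {proj₁ jx} {x , x≤m0} s≤ (⊑-reflexive (sym eq))))
      , λ y y≤x y≢x → below (y , ⊑-trans y≤x x≤m0) y≤x (y≢x ∘ cong proj₁))

  abstract
    -- As `m0` is meet-irreducible, it is `κ(j)` for some `j`. This `j` is not below `m0`, hence is
    -- above `j0`, and `matched-across-prime` identifies the two.
    κ-prime : ∀ {j0 m0} → PrimePair L j0 m0 → JI L j0 × κ j0 ≡ m0
    κ-prime {j0} {m0} prime with Pairing.surj pairing m0 (matched⇒MI (prime-matched lattice prime))
    ... | j , jj , refl with prime j
    ...   | inj₁ (j≤m0 , _) = contradiction j≤m0 (Matched.⋢ (matched fin up j jj))
    ...   | inj₂ (j0≤j , _)
      with refl ← matched-across-prime lattice prime (matched fin up j jj) j0≤j ⊑-refl = jj , refl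

-- An interval crossing the prime pair, built from its upper piece `U` and lower piece `D`.

module PrimeInterval
  {L I : BPoset} (fin : Finite L) (up : UniquelyPaired L) (finI : Finite I)
  (dInd : DIndependent L up) (uInd : UIndependent L up)
  {u v : C L} {e : C I → C L} (u⊑v : _≤_ L u v) (E : Embeds L I u v e)
  {j0 m0 : C L} (prime : PrimePair L j0 m0) (u⊑m0 : _≤_ L u m0) (j0⊑v : _≤_ L j0 v)
  {i0 n0 : C I} (i0-join : IsJoin L u j0 (e i0)) (n0-meet : IsMeet L v m0 (e n0))
  (upU : UniquelyPaired (UpSet I i0)) (upD : UniquelyPaired (DownSet I n0))
  (corrU : Corresponds L up (UpSet I i0) upU (e i0) v (e ∘ proj₁))
  (corrD : Corresponds L up (DownSet I n0) upD u (e n0) (e ∘ proj₁))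
  where
  open Order L
  open UniquelyPaired up
  open Embedding lattice E
  private
    U = UpSet I i0
    D = DownSet I n0
    module I = Order I
    module U = Order U
    module D = Order D
    module FI = FiniteOrder I finI
    module ED = Embedding lattice (down-embeds E n0)
    module CorrU = Corresponds corrU
    module CorrD = Corresponds corrD
    open UniquelyPaired upU using () renaming (κ to κU)
    open UniquelyPaired upD using () renaming (κ to κD)

  jj0 : JI L j0
  jj0 = proj₁ (κ-prime fin up prime)

  κj0≡m0 : κ j0 ≡ m0
  κj0≡m0 = proj₂ (κ-prime fin up prime)

  j0⊑i0 : j0 ⊑ e i0
  j0⊑i0 = proj₁ (proj₂ i0-join)

  n0⊑m0 : e n0 ⊑ m0
  n0⊑m0 = proj₁ (proj₂ n0-meet)

  i0⊑ : ∀ {x} → j0 ⊑ e x → i0 I.⊑ x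
  i0⊑ j0≤x = reflect (proj₂ (proj₂ i0-join) _ (u⊑ _) j0≤x)

  ⊑n0 : ∀ {x} → e x ⊑ m0 → x I.⊑ n0
  ⊑n0 x≤m0 = reflect (proj₂ (proj₂ n0-meet) _ (⊑v _) x≤m0)

  primeI : PrimePair I i0 n0
  primeI x with prime (e x)
  ... | inj₁ (x≤m0 , j0≰x) = inj₁ (⊑n0 x≤m0 , λ i0≤x → j0≰x (⊑-trans j0⊑i0 (mono i0≤x)))
  ... | inj₂ (j0≤x , x≰m0) = inj₂ (i0⊑ j0≤x , λ x≤n0 → x≰m0 (⊑-trans (mono x≤n0) n0⊑m0))

  -- Everything in `I` below an element of `D` is already in `D`. The analogue for `U`,
  -- `lower-from-U`, takes independence.
  lower-from-D : ∀ {d s} → D.Lower d s → I.Lower (proj₁ d) (proj₁ s)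
  lower-from-D {d} {s} (s≤ , s≢ , below) =
    s≤ , (λ eq → s≢ (D.⊑-antisym {s} {d} s≤ (I.⊑-reflexive (sym eq)))) ,
    λ x x≤d x≢d → below (x , I.⊑-trans x≤d (proj₂ d)) x≤d (x≢d ∘ cong proj₁)

  upper-from-U : ∀ {m t} → U.Upper m t → I.Upper (proj₁ m) (proj₁ t)
  upper-from-U {m} {t} (≤t , ≢t , above) =
    ≤t , (λ eq → ≢t (U.⊑-antisym {m} {t} ≤t (I.⊑-reflexive (sym eq)))) ,
    λ x m≤x m≢x → above (x , I.⊑-trans (proj₂ m) m≤x) m≤x (m≢x ∘ cong proj₁)

  lower-to-U : ∀ {i s} (i0≤i : i0 I.⊑ i) → i0 ≢ i → I.Lower i s →
    Σ (i0 I.⊑ s) λ i0≤s → U.Lower (i , i0≤i) (s , i0≤s)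
  lower-to-U {i} {s} i0≤i i0≢i (s≤ , s≢ , below) =
    below i0 i0≤i i0≢i , s≤ , s≢ ∘ cong proj₁ ,
    λ x x≤i x≢i → below (proj₁ x) x≤i
      (λ eq → x≢i (U.⊑-antisym {x} {i , i0≤i} x≤i (I.⊑-reflexive (sym eq))))

  upper-to-D : ∀ {m t} (m≤n0 : m I.⊑ n0) → m ≢ n0 → I.Upper m t →
    Σ (t I.⊑ n0) λ t≤n0 → D.Upper (m , m≤n0) (t , t≤n0)
  upper-to-D {m} {t} m≤n0 m≢n0 (≤t , ≢t , above) =
    above n0 m≤n0 m≢n0 , ≤t , ≢t ∘ cong proj₁ ,
    λ x m≤x m≢x → above (proj₁ x) m≤x
      (λ eq → m≢x (D.⊑-antisym {m , m≤n0} {x} m≤x (I.⊑-reflexive (sym eq))))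

  abstract
    U-matched : ∀ {j} → JI L j → j0 ⊑ κ j → u ⊑ κ j → j ⊑ v → ∀ {a m} →
      IsJoin L (e i0) j (e (proj₁ a)) → IsMeet L v (κ j) (e m) →
      Σ (i0 I.⊑ m) λ i0≤m → U.Matched a (m , i0≤m)
    U-matched {j} jj j0≤κ u≤κ j≤v {a} {m} is-a is-m =
      subst (i0 I.⊑_) κa≡m (proj₂ (κU a)) ,
      subst (U.Matched a) (U.⊑-antisym {κU a} (I.⊑-reflexive κa≡m) (I.⊑-reflexive (sym κa≡m)))
        (matched (finite-sub I _ finI) upU a (CorrU.irreducible jj i0≤κ j≤v a is-a))
      where
      i0≤κ : e i0 ⊑ κ j
      i0≤κ = proj₂ (proj₂ i0-join) _ u≤κ j0≤κ
      κa≡m : proj₁ (κU a) ≡ m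
      κa≡m = e-injective (meet-unique (CorrU.label jj i0≤κ j≤v a is-a) is-m)

    D-matched : ∀ {j} → JI L j → j ⊑ m0 → u ⊑ κ j → j ⊑ v → ∀ {i m} →
      IsJoin L u j (e i) → IsMeet L (e n0) (κ j) (e (proj₁ m)) →
      Σ (i I.⊑ n0) λ i≤n0 → D.Matched (i , i≤n0) m
    D-matched {j} jj j≤m0 u≤κ j≤v {i} {m} is-i is-m =
      i≤n0 ,
      subst (D.Matched d) (D.⊑-antisym {κD d} {m} (I.⊑-reflexive κd≡m) (I.⊑-reflexive (sym κd≡m)))
        (matched (finite-sub I _ finI) upD d (CorrD.irreducible jj u≤κ j≤n0 d is-i))
      where
      j≤n0 : j ⊑ e n0
      j≤n0 = proj₂ (proj₂ n0-meet) _ j≤v j≤m0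
      i≤n0 : i I.⊑ n0
      i≤n0 = reflect (proj₂ (proj₂ is-i) _ (u⊑ n0) j≤n0)
      d : C D
      d = i , i≤n0
      κd≡m : proj₁ (κD d) ≡ proj₁ m
      κd≡m = e-injective (meet-unique (CorrD.label jj u≤κ j≤n0 d is-i) is-m)

  -- A lower cover of u ∨ j outside [i0 , 1] would put j0 and j together in
  -- 𝒟_L(u ∨ j), although j → j0 is an edge of the Galois graph.
  abstract
    lower-from-U : ∀ {j i m s} → JI L j → j0 ⊑ j → j ≢ j0 → (i0≤i : i0 I.⊑ i) → j ⊑ e i →
      e m ⊑ κ j → U.Lower (i , i0≤i) s → proj₁ s I.⊑ m → I.Lower i (proj₁ s)
    lower-from-U {j} {i} {m} {s} jj j0≤j j≢j0 i0≤i j≤i m≤κ (s≤ , s≢ , below) s≤m =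
      s≤ , s≢I , belowI
      where
      s≢I : proj₁ s ≢ i
      s≢I eq = s≢ (U.⊑-antisym {s} {i , i0≤i} s≤ (I.⊑-reflexive (sym eq)))

      belowI : ∀ x → x I.⊑ i → x ≢ i → x I.⊑ proj₁ s
      belowI x x≤i x≢i with FI.cover-below x≤i x≢i
      ... | y , x≤y , y⋖i@(y≤i , y≢i , _) with primeI y
      ...   | inj₂ (i0≤y , _) = I.⊑-trans x≤y (below (y , i0≤y) y≤i (y≢i ∘ cong proj₁))
      ...   | inj₁ (y≤n0 , _) with FI.cover-below s≤ s≢I
      ...     | z , s≤z , z⋖i@(z≤i , z≢i , _) = ⊥-elim (dInd (e i) (e z) (e y)
        (preserve-cover z⋖i) (preserve-cover y⋖i) j j0
        (jj , ⊑-trans (mono (I.⊑-trans (below (z , i0≤z) z≤i (z≢i ∘ cong proj₁)) s≤m)) m≤κ)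
        (jj , j≤i)
        (jj0 , ⊑-trans (mono y≤n0) (⊑-trans n0⊑m0 (⊑-reflexive (sym κj0≡m0))))
        (jj0 , ⊑-trans j0≤j j≤i)
        (j≢j0 , λ j≤κj0 → prime-⋢ lattice prime
          (⊑-trans j0≤j (⊑-trans j≤κj0 (⊑-reflexive κj0≡m0)))))
        where
        i0≤z : i0 I.⊑ z
        i0≤z = I.⊑-trans (proj₂ s) s≤z

    -- Dual to `lower-from-U`: an upper cover of `m` outside `D` carries the label `j0`, so `j0` and
    -- `j` would both lie in `𝒰_L(m)`. The edge now runs from `j0` to `j`, because `κ(j) ≤ m0`.
    upper-from-D : ∀ {j i m t} → JI L j → κ j ⊑ m0 → j ⊑ m0 → (m≤n0 : m I.⊑ n0) → e m ⊑ κ j →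
      j ⊑ e i → D.Upper (m , m≤n0) t → i I.⊑ proj₁ t → I.Upper m (proj₁ t)
    upper-from-D {j} {i} {m} {t} jj κ≤m0 j≤m0 m≤n0 m≤κ j≤i (≤t , ≢t , above) i≤t =
      ≤t , ≢tI , aboveI
      where
      ≢tI : m ≢ proj₁ t
      ≢tI eq = ≢t (D.⊑-antisym {m , m≤n0} {t} ≤t (I.⊑-reflexive (sym eq)))

      aboveI : ∀ x → m I.⊑ x → m ≢ x → proj₁ t I.⊑ x
      aboveI x m≤x m≢x with FI.cover-above m≤x m≢x
      ... | y , m⋖y@(m≤y , m≢y , _) , y≤x with primeI y
      ...   | inj₁ (y≤n0 , _) = I.⊑-trans (above (y , y≤n0) m≤y (m≢y ∘ cong proj₁)) y≤x
      -- A second cover, inside `D`: `z` is above `t`, hence above `j`, so the cover from `m` to `z`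
      -- has label `j`.
      ...   | inj₂ (i0≤y , _) with FI.cover-above ≤t ≢tI
      ...     | z , m⋖z@(m≤z , m≢z , _) , z≤t = ⊥-elim (uInd (e m) (e y) (e z)
        (preserve-cover m⋖y) (preserve-cover m⋖z) j0 j
        (jj0 , ⊑-trans m≤κ (⊑-trans κ≤m0 (⊑-reflexive (sym κj0≡m0))))
        (jj0 , ⊑-trans j0⊑i0 (mono i0≤y))
        (jj , m≤κ)
        (jj , ⊑-trans j≤i (mono (I.⊑-trans i≤t (above (z , z≤n0) m≤z (m≢z ∘ cong proj₁)))))
        ( (λ j0≡j → prime-⋢ lattice prime (⊑-trans (⊑-reflexive j0≡j) j≤m0))
        , λ j0≤κ → prime-⋢ lattice prime (⊑-trans j0≤κ κ≤m0)))
        where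
        z≤n0 : z I.⊑ n0
        z≤n0 = I.⊑-trans z≤t (proj₂ t)

  join-via-i0 : ∀ {j i a} → IsJoin L u j (e i) → IsJoin I i0 i a → IsJoin L (e i0) j (e a)
  join-via-i0 (_ , j≤i , least) (i0≤a , i≤a , least') =
    mono i0≤a , ⊑-trans j≤i (mono i≤a) ,
    λ w i0≤w j≤w → proj₂ (proj₂ (preserve-join (i0≤a , i≤a , least'))) w i0≤w
      (least w (⊑-trans (u⊑ i0) i0≤w) j≤w)

  meet-via-n0 : ∀ {x m b} → IsMeet L v x (e m) → IsMeet I n0 m b → IsMeet L (e n0) x (e b)
  meet-via-n0 (_ , m≤x , most) (b≤n0 , b≤m , most') =
    mono b≤n0 , ⊑-trans (mono b≤m) m≤x ,
    λ w w≤n0 w≤x → proj₂ (proj₂ (preserve-meet (b≤n0 , b≤m , most'))) w w≤n0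
      (most w (⊑-trans w≤n0 (⊑v n0)) w≤x)

  open IsLattice lattice-in using (∨-isJoin; ⊓-isMeet)
    renaming (_∨_ to _∨I_; _⊓_ to _⊓I_)

  -- The cases are the sides of `j` and `κ(j)`. For `j ≤ m0` the lower cover of `i` comes from `D`;
  -- for `j0 ≤ κ(j)` the upper cover of `m` comes from `U`; if both hold, each piece gives one half.
  -- With `j` and `κ(j)` on the same side, one piece gives both covers and independence carries one
  -- of them over to `I`. The remaining case forces `j` to be `j0`.
  match : ∀ {j} → JI L j → u ⊑ κ j → j ⊑ v → ∀ {i m} →
    IsJoin L u j (e i) → IsMeet L v (κ j) (e m) → I.Matched i m
  match {j} jj u≤κ j≤v {i} {m} is-i@(_ , j≤i , _) is-m@(_ , m≤κ , _) with prime j | prime (κ j)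
  ... | inj₁ (j≤m0 , _) | inj₁ (κ≤m0 , _) = record
    { lower = proj₁ M.lower
    ; upper = proj₁ M.upper
    ; isLower = lower-from-D M.isLower
    ; isUpper = upper-from-D jj κ≤m0 j≤m0 m≤n0 m≤κ j≤i M.isUpper M.⊑upper
    ; lower⊑ = M.lower⊑
    ; ⊑upper = M.⊑upper
    ; ⋢ = M.⋢
    }
    where
    m≤n0 : m I.⊑ n0
    m≤n0 = ⊑n0 (⊑-trans m≤κ κ≤m0)
    module M = D.Matched (proj₂ (D-matched jj j≤m0 u≤κ j≤v {m = m , m≤n0} is-i
      (mono m≤n0 , m≤κ , λ w w≤n0 w≤κ → proj₂ (proj₂ is-m) w (⊑-trans w≤n0 (⊑v n0)) w≤κ)))
  ... | inj₁ (j≤m0 , _) | inj₂ (j0≤κ , _) = record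
    { lower = proj₁ M.lower
    ; upper = proj₁ M'.upper
    ; isLower = lower-from-D M.isLower
    ; isUpper = upper-from-U M'.isUpper
    ; lower⊑ = I.⊑-trans M.lower⊑ (proj₁ (proj₂ (⊓-isMeet n0 m)))
    ; ⊑upper = I.⊑-trans (proj₁ (proj₂ (∨-isJoin i0 i))) M'.⊑upper
    ; ⋢ = λ i≤m → Matched.⋢ (matched fin up j jj) (⊑-trans j≤i (⊑-trans (mono i≤m) m≤κ))
    }
    where
    module M = D.Matched (proj₂ (D-matched jj j≤m0 u≤κ j≤v
      {m = n0 ⊓I m , proj₁ (⊓-isMeet n0 m)} is-i (meet-via-n0 is-m (⊓-isMeet n0 m))))
    module M' = U.Matched (proj₂ (U-matched jj j0≤κ u≤κ j≤v
      {a = i0 ∨I i , proj₁ (∨-isJoin i0 i)} (join-via-i0 is-i (∨-isJoin i0 i)) is-m))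
  ... | inj₂ (j0≤j , _) | inj₁ (κ≤m0 , _)
    with refl ← matched-across-prime lattice prime (matched fin up j jj) j0≤j κ≤m0
    with refl ← e-injective {i} {i0} (join-unique is-i i0-join)
    with refl ← e-injective {m} {n0} (meet-unique is-m
                  (subst (λ x → IsMeet L v x (e n0)) (sym κj0≡m0) n0-meet))
    = I.prime-matched lattice-in primeI
  ... | inj₂ (j0≤j , _) | inj₂ (j0≤κ , _) = record
    { lower = proj₁ M.lower
    ; upper = proj₁ M.upper
    ; isLower = lower-from-U jj j0≤j j≢j0 i0≤i j≤i m≤κ M.isLower M.lower⊑
    ; isUpper = upper-from-U M.isUpper
    ; lower⊑ = M.lower⊑
    ; ⊑upper = M.⊑upper
    ; ⋢ = M.⋢
    }
    where
    i0≤i : i0 I.⊑ i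
    i0≤i = i0⊑ (⊑-trans j0≤j j≤i)
    j≢j0 : j ≢ j0
    j≢j0 refl = prime-⋢ lattice prime (⊑-trans j0≤κ (⊑-reflexive κj0≡m0))
    module M = U.Matched (proj₂ (U-matched jj j0≤κ u≤κ j≤v {a = i , i0≤i}
      (mono i0≤i , j≤i , λ w i0≤w j≤w → proj₂ (proj₂ is-i) w (⊑-trans (u⊑ i0) i0≤w) j≤w) is-m))

  abstract
    -- The critical case is `i` strictly above `i0`, where `U` only gives `i = i0 ∨ j`. If `j0 ≤ j`,
    -- this is `u ∨ j`. If `j ≤ m0`, then `u ∨ j ≤ m0` is strictly below `i`, so both it and `i0`
    -- lie below the lower cover of `i`, and so would their join `i`.
    ontoJ : ∀ i → JI I i → Σ (C L) λ j → JI L j × u ⊑ κ j × j ⊑ v × IsJoin L u j (e i)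
    ontoJ i ji with primeI i
    ... | inj₁ (i≤n0 , _) with FI.JI⇒lower ji
    ...   | s≤ , s≢ , below
      with j , jj , u≤κ , j≤n0 , is-i ← CorrD.onto (i , i≤n0) (D.lower⇒JI
        {s = proj₁ ji , I.⊑-trans s≤ i≤n0}
        (s≤ , s≢ ∘ cong proj₁ , λ x x≤i x≢i → below (proj₁ x) x≤i
          (λ eq → x≢i (D.⊑-antisym {x} {i , i≤n0} x≤i (I.⊑-reflexive (sym eq))))))
      = j , jj , u≤κ , ⊑-trans j≤n0 (⊑v n0) , is-i
    ontoJ i ji | inj₂ (i0≤i , _) with i0 I.≟ i
    ... | yes refl = j0 , jj0 , ⊑-trans u⊑m0 (⊑-reflexive (sym κj0≡m0)) , j0⊑v , i0-join
    ... | no i0≢i with lower-to-U i0≤i i0≢i (FI.JI⇒lower ji)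
    ...   | i0≤s , low with CorrU.onto (i , i0≤i) (U.lower⇒JI low)
    ...     | j , jj , i0≤κ , j≤v , is-i@(_ , j≤i , least)
      with join-in ⊑-refl u⊑v j≤v | prime j
    ...       | _ | inj₂ (j0≤j , _) = j , jj , ⊑-trans (u⊑ i0) i0≤κ , j≤v , u⊑ i , j≤i ,
      λ w u≤w j≤w → least w (proj₂ (proj₂ i0-join) w u≤w (⊑-trans j0≤j j≤w)) j≤w
    ...       | k , u≤k , j≤k , least' | inj₁ (j≤m0 , _) = contradiction
      (I.⊑-antisym (proj₁ low) (reflect (least _ (mono i0≤s) (⊑-trans j≤k (mono k≤s)))))
      (proj₁ (proj₂ (FI.JI⇒lower ji)))
      where
      k≤s : k I.⊑ proj₁ ji
      k≤s = proj₂ (proj₂ (FI.JI⇒lower ji)) k (reflect (least' _ (u⊑ i) j≤i))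
        λ { refl → prime-⋢ lattice prime
              (⊑-trans j0⊑i0 (⊑-trans (mono i0≤i) (least' m0 u⊑m0 j≤m0))) }

    -- Dual to `ontoJ`, with labels found by first passing from `m` to its partner in `U` or `D`. In
    -- the critical case `m = n0 ∧ κ(j)`; if `j0 ≤ κ(j)`, then `j0 ≤ v ∧ κ(j)`, so `v ∧ κ(j)` and
    -- `n0` are both strictly above `m`, and their meet could not be `m`.
    ontoM : ∀ m → MI I m → Σ (C L) λ j → JI L j × u ⊑ κ j × j ⊑ v × IsMeet L v (κ j) (e m)
    ontoM m mm with primeI m
    ... | inj₂ (i0≤m , _) with FI.MI⇒upper mm
    ...   | ≤t , ≢t , above
      with Pairing.surj (UniquelyPaired.pairing upU) (m , i0≤m) (U.upper⇒MI
        {t = proj₁ mm , I.⊑-trans i0≤m ≤t}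
        (≤t , ≢t ∘ cong proj₁ , λ x m≤x m≢x → above (proj₁ x) m≤x
          (λ eq → m≢x (U.⊑-antisym {m , i0≤m} {x} m≤x (I.⊑-reflexive (sym eq))))))
    ...     | a , ja , κa≡m with CorrU.onto a ja
    ...       | j , jj , i0≤κ , j≤v , is-a = j , jj , ⊑-trans (u⊑ i0) i0≤κ , j≤v ,
      subst (IsMeet L v (κ j)) (cong (e ∘ proj₁) κa≡m) (CorrU.label jj i0≤κ j≤v a is-a)
    ontoM m mm | inj₁ (m≤n0 , _) with m I.≟ n0
    ... | yes refl = j0 , jj0 , ⊑-trans u⊑m0 (⊑-reflexive (sym κj0≡m0)) , j0⊑v ,
      subst (λ x → IsMeet L v x (e n0)) (sym κj0≡m0) n0-meet
    ... | no m≢n0 with upper-to-D m≤n0 m≢n0 (FI.MI⇒upper mm)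
    ...   | t≤n0 , upp with Pairing.surj (UniquelyPaired.pairing upD) (m , m≤n0) (D.upper⇒MI upp)
    ...     | d , jd , κd≡m with CorrD.onto d jd
    ...       | j , jj , u≤κ , j≤n0 , is-d
      with subst (IsMeet L (e n0) (κ j)) (cong (e ∘ proj₁) κd≡m) (CorrD.label jj u≤κ j≤n0 d is-d)
         | meet-in ⊑-refl u⊑v u≤κ | prime (κ j)
    ...         | _ , m≤κ , most | _ | inj₁ (κ≤m0 , _) =
      j , jj , u≤κ , ⊑-trans j≤n0 (⊑v n0) , ⊑v m , m≤κ ,
      λ w w≤v w≤κ → most w (proj₂ (proj₂ n0-meet) w w≤v (⊑-trans w≤κ κ≤m0)) w≤κ
    ...         | _ , m≤κ , most | k , k≤v , k≤κ , most' | inj₂ (j0≤κ , _) = contradiction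
      (I.⊑-antisym (proj₁ upp) (reflect (most _ (mono t≤n0) (⊑-trans (mono t≤k) k≤κ))))
      (proj₁ (proj₂ (FI.MI⇒upper mm)))
      where
      t≤k : proj₁ mm I.⊑ k
      t≤k = proj₂ (proj₂ (FI.MI⇒upper mm)) k (reflect (most' _ (⊑v m) m≤κ))
        λ { refl → prime-⋢ lattice prime
              (⊑-trans (most' j0 j0⊑v j0≤κ) (⊑-trans (mono m≤n0) n0⊑m0)) }

  open IntervalPairing fin up finI u⊑v E match ontoJ ontoM public
    using (upI; corresponds; κI)
  private
    module CI = Corresponds corresponds

  -- In terms of labels the map sends `u ∨ j` to `(u ∨ j0) ∨ j`, with the same `j`; and
  -- `i0 ≤ v ∧ κ(j)` amounts to `u ∨ j0 ≤ κ(j)`. Everything is thus read off from the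
  -- correspondences of `I` and `U` with `L`.
  condI : CondI I upI i0 upU
  condI = image , image-injective , image-onto
    where
    image : ∀ i → JI I i → i0 I.⊑ κI i → ∀ a → proj₁ a ≡ i0 ∨I i →
      JI U a × proj₁ (κU a) ≡ κI i
    image i ji i0≤κ (_ , i0≤a) refl with ontoJ i ji
    ... | j , jj , u≤κ , j≤v , is-i =
      CorrU.irreducible jj i0≤κj j≤v _ is-a ,
      e-injective (meet-unique (CorrU.label jj i0≤κj j≤v _ is-a) is-m)
      where
      is-m = CI.label jj u≤κ j≤v i is-i
      i0≤κj = ⊑-trans (mono i0≤κ) (proj₁ (proj₂ is-m))
      is-a = join-via-i0 is-i (∨-isJoin i0 i)

    image-injective : ∀ i i' → JI I i → i0 I.⊑ κI i → JI I i' → i0 I.⊑ κI i' →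
      i0 ∨I i ≡ i0 ∨I i' → i ≡ i'
    image-injective i i' ji i0≤κ ji' i0≤κ' eq with ontoJ i ji | ontoJ i' ji'
    ... | j , jj , u≤κ , j≤v , is-i | j' , jj' , u≤κ' , j'≤v , is-i'
      with refl ← CorrU.injective jj
             (⊑-trans (mono i0≤κ) (proj₁ (proj₂ (CI.label jj u≤κ j≤v i is-i)))) j≤v
             jj' (⊑-trans (mono i0≤κ') (proj₁ (proj₂ (CI.label jj' u≤κ' j'≤v i' is-i')))) j'≤v
             (i0 ∨I i , proj₁ (∨-isJoin i0 i))
             (join-via-i0 is-i (∨-isJoin i0 i))
             (join-via-i0 is-i' (subst (IsJoin I i0 i') (sym eq) (∨-isJoin i0 i')))
      = e-injective (join-unique is-i is-i')

    image-onto : ∀ a → JI U a →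
      Σ (C I) λ i → JI I i × i0 I.⊑ κI i × proj₁ a ≡ i0 ∨I i
    image-onto a ja with CorrU.onto a ja
    ... | j , jj , i0≤κ , j≤v , is-a with join-in ⊑-refl u⊑v j≤v
    ...   | i , is-i = i , CI.irreducible jj u≤κ j≤v i is-i ,
      reflect (proj₂ (proj₂ (CI.label jj u≤κ j≤v i is-i)) _ (⊑v i0) i0≤κ) ,
      e-injective (join-unique is-a (join-via-i0 is-i (∨-isJoin i0 i)))
      where
      u≤κ = ⊑-trans (u⊑ i0) i0≤κ

  -- An element `i ≤ n0` has the same label in `D` as in `I`, and its partner in `D` is the meet of
  -- `n0` with its partner in `I`.
  condII : CondII I upI n0 upD
  condII = image , image-injective , image-onto
    where
    image : ∀ i → JI I i → i I.⊑ n0 → ∀ b → proj₁ b ≡ n0 ⊓I κI i →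
      MI D b × Σ (C D) λ d → proj₁ d ≡ i × JI D d × κD d ≡ b
    image i ji i≤n0 b b≡ with ontoJ i ji
    ... | j , jj , u≤κ , j≤v , is-i =
      subst (MI D) κd≡b (Pairing.maps (UniquelyPaired.pairing upD) d jd) , d , refl , jd , κd≡b
      where
      d : C D
      d = i , i≤n0
      j≤n0 = ⊑-trans (proj₁ (proj₂ is-i)) (mono i≤n0)
      jd = CorrD.irreducible jj u≤κ j≤n0 d is-i
      κd≡b : κD d ≡ b
      κd≡b = ED.e-injective (meet-unique (CorrD.label jj u≤κ j≤n0 d is-i)
        (meet-via-n0 (CI.label jj u≤κ j≤v i is-i)
          (subst (IsMeet I n0 (κI i)) (sym b≡) (⊓-isMeet n0 (κI i)))))

    image-injective : ∀ i i' → JI I i → i I.⊑ n0 → JI I i' → i' I.⊑ n0 →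
      n0 ⊓I κI i ≡ n0 ⊓I κI i' → κI i ≡ κI i'
    image-injective i i' ji i≤n0 ji' i'≤n0 eq
      with image i ji i≤n0 (n0 ⊓I κI i , proj₁ (⊓-isMeet n0 (κI i))) refl
         | image i' ji' i'≤n0 (n0 ⊓I κI i , proj₁ (⊓-isMeet n0 (κI i))) eq
    ... | _ , d , refl , jd , κd | _ , d' , refl , jd' , κd' =
      cong (κI ∘ proj₁) (Pairing.inj (UniquelyPaired.pairing upD) d d' jd jd' (trans κd (sym κd')))

    image-onto : ∀ b → MI D b →
      Σ (C I) λ i → JI I i × i I.⊑ n0 × proj₁ b ≡ n0 ⊓I κI i
    image-onto b mb with Pairing.surj (UniquelyPaired.pairing upD) b mb
    ... | d , jd , refl with CorrD.onto d jd
    ...   | j , jj , u≤κ , j≤n0 , is-d =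
      proj₁ d , CI.irreducible jj u≤κ j≤v (proj₁ d) is-d , proj₂ d ,
      e-injective (meet-unique (CorrD.label jj u≤κ j≤n0 d is-d)
        (meet-via-n0 (CI.label jj u≤κ j≤v (proj₁ d) is-d) (⊓-isMeet n0 (κI (proj₁ d)))))
      where
      j≤v = ⊑-trans j≤n0 (⊑v n0)

-- Induction on the dismantling.

dismantle : ∀ {L up} → CD L up → Finite L → DIndependent L up → UIndependent L up →
  ∀ {I u v e} → _≤_ L u v → Finite I → Embeds L I u v e →
  Σ (UniquelyPaired I) λ upI → CD I upI × Corresponds L up I upI u v e
dismantle {L} (cd-single up single) fin _ _ {I} {u} {v} {e} u≤v finI E =
  upI , cd-single upI singleI , corresponds
  where
  open UniquelyPaired up
  open Embedding lattice E

  singleI : ∀ x y → x ≡ y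
  singleI x y = e-injective (single (e x) (e y))

  no-JI : ∀ {K : BPoset} → (∀ (x y : C K) → x ≡ y) → ∀ {j} → ¬ JI K j
  no-JI single (s , (_ , s≢j , _) , _) = s≢j (single s _)

  no-MI : ∀ {K : BPoset} → (∀ (x y : C K) → x ≡ y) → ∀ {m} → ¬ MI K m
  no-MI single (t , (_ , m≢t , _) , _) = m≢t (single _ t)

  open IntervalPairing fin up finI u≤v E
    (λ jj → contradiction jj (no-JI {L} single))
    (λ _ ji → contradiction ji (no-JI {I} singleI))
    (λ _ mm → contradiction mm (no-MI {I} singleI))
dismantle {L} (cd-step up j0 m0 prime upU cdU cI upD cdD cII) fin dInd uInd {I} {u} {v} {e}
          u≤v finI E = by-position (prime u) (prime v)
  where
  open Order L
  open UniquelyPaired up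
  open Embedding lattice E

  -- `Embeds` asks for two bounds, so the up-set is viewed as ending at the top of `L` and the
  -- down-set as starting at the bottom.
  ⊤L = proj₁ (FiniteOrder.top L fin lattice u)
  ⊥L = proj₁ (FiniteOrder.bottom L fin lattice u)
  ⊑⊤ = proj₂ (FiniteOrder.top L fin lattice u)
  ⊥⊑ = proj₂ (FiniteOrder.bottom L fin lattice u)

  EU : Embeds L (UpSet L j0) j0 ⊤L proj₁
  EU = embeds-up lattice ⊑⊤
  CorrU : Corresponds L up (UpSet L j0) upU j0 ⊤L proj₁
  CorrU = corresponds-up fin up ⊑⊤ cI
  ED : Embeds L (DownSet L m0) ⊥L m0 proj₁
  ED = embeds-down lattice ⊥⊑
  CorrD : Corresponds L up (DownSet L m0) upD ⊥L m0 proj₁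
  CorrD = corresponds-down fin up ⊥⊑ cII

  Result : (I : BPoset) (u v : C L) (e : C I → C L) → Set₁
  Result I u v e = Σ (UniquelyPaired I) λ upI → CD I upI × Corresponds L up I upI u v e

  in-U : ∀ {I u v e} → j0 ⊑ u → u ⊑ v → Finite I → Embeds L I u v e → Result I u v e
  in-U {I} {u} {v} {e} j0≤u u≤v finI E
    with EK ← embeds-in-sub E {λ x → BPoset._≤ᵇ_ L j0 x} j0≤u (⊑-trans j0≤u u≤v)
                (λ i → ⊑-trans j0≤u (Embeds.u⊑ E i))
    with upI , cdI , corr ← dismantle cdU (finite-sub L _ fin)
                (transfer-D EU CorrU dInd) (transfer-U EU CorrU uInd) u≤v finI EK
    = upI , cdI , corresponds-trans EU EK CorrU corr

  in-D : ∀ {I u v e} → v ⊑ m0 → u ⊑ v → Finite I → Embeds L I u v e → Result I u v e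
  in-D {I} {u} {v} {e} v≤m0 u≤v finI E
    with EK ← embeds-in-sub E {λ x → BPoset._≤ᵇ_ L x m0} (⊑-trans u≤v v≤m0) v≤m0
                (λ i → ⊑-trans (Embeds.⊑v E i) v≤m0)
    with upI , cdI , corr ← dismantle cdD (finite-sub L _ fin)
                (transfer-D ED CorrD dInd) (transfer-U ED CorrD uInd) u≤v finI EK
    = upI , cdI , corresponds-trans ED EK CorrD corr

  -- The pieces [u ∨ j0 , v] and [u , v ∧ m0] lie in [j0 , 1] and [0 , m0]. The recursive calls are
  -- made for `UpSet I i0` and `DownSet I n0`, embedded directly in `L`, because these are the
  -- posets that `cd-step` demands.
  across : u ⊑ m0 → j0 ⊑ v → Result I u v e
  across u≤m0 j0≤v with join-in ⊑-refl u≤v j0≤v | meet-in ⊑-refl u≤v u≤m0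
  ... | i0 , is-i0 | n0 , is-n0
    with in-U (proj₁ (proj₂ is-i0)) (⊑v i0) (finite-sub I _ finI) (up-embeds E i0)
       | in-D (proj₁ (proj₂ is-n0)) (u⊑ n0) (finite-sub I _ finI) (down-embeds E n0)
  ...   | upU' , cdU' , corrU | upD' , cdD' , corrD =
    upI , cd-step upI i0 n0 primeI upU' cdU' condI upD' cdD' condII , corresponds
    where
    open PrimeInterval fin up finI dInd uInd u≤v E prime u≤m0 j0≤v is-i0 is-n0
      upU' upD' corrU corrD

  by-position : (u ⊑ m0 × ¬ j0 ⊑ u) ⊎ (j0 ⊑ u × ¬ u ⊑ m0) →
    (v ⊑ m0 × ¬ j0 ⊑ v) ⊎ (j0 ⊑ v × ¬ v ⊑ m0) → Result I u v e
  by-position (inj₂ (j0≤u , _)) _ = in-U j0≤u u≤v finI E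
  by-position (inj₁ _) (inj₁ (v≤m0 , _)) = in-D v≤m0 u≤v finI E
  by-position (inj₁ (u≤m0 , _)) (inj₂ (j0≤v , _)) = across u≤m0 j0≤v

theorem7p8 : (L : BPoset) → Finite L → Semidistrim L →
    (u v : BPoset.C L) → _≤_ L u v →
    Finite (Interval L u v) × Semidistrim (Interval L u v)
theorem7p8 L fin ((up , cd) , dInd , uInd) u v u≤v =
  let E = interval-embeds L u v
      finI = finite-sub L _ fin
      upI , cdI , corr = dismantle cd fin dInd uInd u≤v finI E
  in finI , (upI , cdI) , transfer-D E corr dInd , transfer-U E corr uInd
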